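{- Every simple edge-colored graph on $n$ vertices with at least $1.1077\,n$ color classes, each containing at least $n/3$ edges, contains a rainbow triangle. Moreover, every simple edge-colored graph on $n$ vertices with at least $1.3481\,n$ color classes, each containing at least $n/4$ edges, contains a rainbow triangle.
   Context: An edge-coloring of a graph $G$ is an arbitrary map $f:E(G)\to\mathbb{N}$ (not necessarily proper); for a color $i$, the set $f^{ -1}(i)$ is the color class of $i$. A rainbow triangle is a triangle in $G$ whose three edges have pairwise distinct colors. A graph is simple if it has no loops or parallel edges. (In the paper's terminology, the pairs $(1.1077,1/3)$ and $(1.3481,1/4)$ are "triangular", where $(\alpha,\beta)$ is triangular if every simple edge-colored graph on $n$ vertices with at least $\alpha n$ color classes, each with at least $\beta n$ edges, has a rainbow triangle.) -}

module Defs where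

open import Data.Nat using (ℕ; _≤_; _*_)
open import Data.Bool using (Bool; true; false; T; _∧_)
open import Data.Fin using (Fin; toℕ)
open import Data.Fin.Base using ()
open import Data.List using (List; length; filter; allFin; cartesianProduct)
open import Data.List.Relation.Unary.All using (All)
open import Data.List.Relation.Unary.Unique.Propositional using (Unique)
open import Data.Product using (_×_; _,_; ∃-syntax)
open import Relation.Binary.PropositionalEquality using (_≡_; _≢_)
open import Relation.Nullary.Decidable using (⌊_⌋; _×-dec_)
import Data.Nat as ℕ

record SimpleGraph (n : ℕ) : Set where
  field
    adj     : Fin n → Fin n → Bool
    sym     : ∀ i j → adj i j ≡ adj j i
    irrefl  : ∀ i → adj i i ≡ false
open SimpleGraph public

-- An (arbitrary, not necessarily proper) edge-colouring of G: a colour in ℕ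
-- for every edge.  Given as a function on ordered vertex pairs that is
-- symmetric on edges (its values on non-edges are irrelevant).
record EdgeColoring {n : ℕ} (G : SimpleGraph n) : Set where
  field
    col    : Fin n → Fin n → ℕ
    colSym : ∀ i j → T (adj G i j) → col i j ≡ col j i
open EdgeColoring public

colorClass : ∀ {n} (G : SimpleGraph n) (f : EdgeColoring G) (c : ℕ) → List (Fin n × Fin n)
colorClass {n} G f c =
  filter (λ (p : Fin n × Fin n) → let (i , j) = p in
            (toℕ i ℕ.<? toℕ j) ×-dec ((adj G i j Data.Bool.≟ true) ×-dec (col f i j ℕ.≟ c)))
         (cartesianProduct (allFin n) (allFin n))

classSize : ∀ {n} (G : SimpleGraph n) (f : EdgeColoring G) (c : ℕ) → ℕ
classSize G f c = length (colorClass G f c)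

HasRainbowTriangle : ∀ {n} (G : SimpleGraph n) (f : EdgeColoring G) → Set
HasRainbowTriangle {n} G f =
  ∃[ i ] ∃[ j ] ∃[ k ]
    (T (adj G i j) × T (adj G j k) × T (adj G i k)
     × col f i j ≢ col f j k × col f j k ≢ col f i k × col f i j ≢ col f i k)

-- (α , β) with α = aN / aD and β = 1 / b is "triangular": every simple
-- edge-coloured graph on n vertices having at least α n colour classes
-- (i.e. at least α n distinct colours), each with at least β n edges,
-- has a rainbow triangle.
Triangular : (aN aD b : ℕ) → Set
Triangular aN aD b =
  ∀ (n : ℕ) → 1 ≤ n → (G : SimpleGraph n) (f : EdgeColoring G) (cs : List ℕ) →
    Unique cs →
    aN * n ≤ aD * length cs →
    All (λ c → n ≤ b * classSize G f c) cs →
    HasRainbowTriangle G f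

{-# OPTIONS --safe #-}
module Submission where

-- Keep exactly k = ⌈n / b⌉ edges of each of the N colours, m = N k edges in all.  A triangle that is
-- not rainbow contains two edges of one colour, so there are at most about N k² / 2 triangles, while
-- Goodman's argument gives a lower bound through codeg x y = n - u x - u y + cb x y, where u x counts
-- the non-neighbours of x, itself included, and cb x y the common ones.  This alone needs N ≥ (b / 4 + 3 / 8) n.
--
-- The improvement: close to equality a colour class is a star whose leaves form a clique, and by
-- convexity, summing over the vertices outside that clique, two leaves have many common non-neighbours
-- on average.  But every common non-neighbour of an edge is a loss in Goodman's bound, and an edge xy
-- is the base of at most about n - k - u x - u y + cb x y monochromatic cherries, so these pairs of
-- leaves cannot all be the same few edges.  Irregular degrees are paid for by their variance, which is
-- another loss in Goodman's bound.

open import Defs hiding (sym)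
open import Data.Bool.Base using (true; T)
open import Data.Bool.Properties using (T?; T-≡)
open import Data.Empty using (⊥; ⊥-elim)
open import Data.Fin.Base using (Fin; zero; suc; toℕ)
import Data.Fin.Properties as Fin
open import Data.Integer.Base using (ℤ; +_; -[1+_]; _+_; _*_; _-_; -_; _≤_; 0ℤ; 1ℤ; -1ℤ; +≤+)
open import Data.Integer.Properties
  using (+-*-semiring; +-mono-≤; +-identityˡ; +-identityʳ; *-assoc; *-comm; *-identityˡ; *-identityʳ;
         *-zeroˡ; *-zeroʳ; *-cancelˡ-≤-pos; pos-*; ≤-refl;
         i≤j⇒0≤j-i; m-n≡m⊖n; ⊖-≥)
open import Data.Integer.Tactic.RingSolver using (solve-∀)
open import Data.List.Base using (List; []; _∷_; foldr; length; lookup; take; cartesianProduct; allFin)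
open import Data.List.Membership.Propositional using (_∈_; _∉_)
import Data.List.Membership.DecPropositional as Membership
open import Data.List.Membership.Propositional.Properties using (∈-lookup)
open import Data.List.Properties using (length-take)
open import Data.List.Relation.Unary.All as All using (All)
import Data.List.Relation.Unary.All.Properties as All
open import Data.List.Relation.Unary.AllPairs using (_∷_)
open import Data.List.Relation.Unary.Any using (here; there)
open import Data.List.Relation.Unary.Unique.Propositional using (Unique)
import Data.List.Relation.Unary.Unique.Propositional.Properties as Unique
open import Data.Nat.Base as ℕ using (ℕ; zero; suc)
open import Data.Nat.DivMod using (m≡m%n+[m/n]*n; m%n<n; m/n*n≤m)
import Data.Nat.Properties as ℕ
open import Data.Product using (_×_; _,_; ∃-syntax; proj₁; proj₂)
open import Data.Product.Properties using (≡-dec)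
open import Data.Sum.Base using (_⊎_; inj₁; inj₂)
open import Function.Bundles using (Equivalence)
open import Relation.Binary.PropositionalEquality
open import Relation.Nullary using (Dec; yes; no; ¬_)
open import Relation.Nullary.Decidable using (_×-dec_; _⊎-dec_; ¬?; decidable-stable)
import Algebra.Properties.Semiring.Sum +-*-semiring as Sum

-- Finite sums of integers

-- The two sides of the improvement meet in one weight on pairs, `h x y = 25 cb - 10 (u x + u y) + 4
-- (n - k)`, summed over all monochromatic cherries. Grouped by colour and centre, the sum is nearly
-- nonnegative: `h` is what the square, replaced by its tangent at density 2/5, gives for a star
-- whose leaves form a clique. Grouped by base, an edge occurs about `q - (k - 1)` times, and the
-- sum becomes a polynomial in `u` and `cb` over the edges, comparable with Goodman's count over the
-- same edges. The tangent point comes from Goodman's extremal case: outside the clique, the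
-- non-neighbours of a leaf have density 3/8 for b = 3 and 5/12 for b = 4. As 2/5 lies between, one
-- set of constants serves both values. The outcome is a quadratic condition `Φ ≥ 0` on the gap `E`
-- in Goodman's bound, which keeps `E` away from 0, whereas many colours mean many edges and so a
-- small `E`.

infix 4 0≤_

-- With zero always on the left, an inequality is proved by a sum of products of nonnegative
-- integers and one ring identity.
0≤_ : ℤ → Set
0≤ x = 0ℤ ≤ x

0≤-resp : ∀ {x y} → x ≡ y → 0≤ y → 0≤ x
0≤-resp refl p = p

0≤ᵐ : ∀ m → 0≤ + m
0≤ᵐ m = +≤+ ℕ.z≤n

0≤-+ : ∀ {x y} → 0≤ x → 0≤ y → 0≤ x + y
0≤-+ = +-mono-≤

0≤-* : ∀ {x y} → 0≤ x → 0≤ y → 0≤ x * y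
0≤-* {+ m} {+ n} _ _ = 0≤-resp (sym (pos-* m n)) (0≤ᵐ (m ℕ.* n))

0≤-sq : ∀ x → 0≤ x * x
0≤-sq (+ m) = 0≤-* (0≤ᵐ m) (0≤ᵐ m)
0≤-sq -[1+ m ] = 0≤ᵐ _

0≤-cancel : ∀ m {x} → 0≤ + suc m * x → 0≤ x
0≤-cancel m {x} p = *-cancelˡ-≤-pos 0ℤ x (+ suc m) (subst (_≤ + suc m * x) (sym (*-zeroʳ (+ suc m))) p)

∑ : ∀ {n} → (Fin n → ℤ) → ℤ
∑ = Sum.sum

module _ {n : ℕ} where
  ∑-cong : {f g : Fin n → ℤ} → (∀ i → f i ≡ g i) → ∑ f ≡ ∑ g
  ∑-cong = Sum.sum-cong-≗

  ∑-+ : ∀ (f g : Fin n → ℤ) → ∑ (λ i → f i + g i) ≡ ∑ f + ∑ g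
  ∑-+ = Sum.∑-distrib-+

  ∑-*ˡ : ∀ c (f : Fin n → ℤ) → ∑ (λ i → c * f i) ≡ c * ∑ f
  ∑-*ˡ c f = sym (Sum.*-distribˡ-sum c f)

  ∑-*ʳ : ∀ c (f : Fin n → ℤ) → ∑ (λ i → f i * c) ≡ ∑ f * c
  ∑-*ʳ c f = sym (Sum.*-distribʳ-sum c f)

  ∑-zero : ∑ {n} (λ _ → 0ℤ) ≡ 0ℤ
  ∑-zero = Sum.sum-replicate-zero n

∑-swap : ∀ {m n} (f : Fin m → Fin n → ℤ) → ∑ (λ i → ∑ (λ j → f i j)) ≡ ∑ (λ j → ∑ (λ i → f i j))
∑-swap = Sum.∑-comm

∑-0≤ : ∀ {n} {f : Fin n → ℤ} → (∀ i → 0≤ f i) → 0≤ ∑ f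
∑-0≤ {zero} p = ≤-refl
∑-0≤ {suc n} p = 0≤-+ (p zero) (∑-0≤ (λ i → p (suc i)))

∑-const : ∀ n c → ∑ {n} (λ _ → c) ≡ + n * c
∑-const zero c = sym (*-zeroˡ c)
∑-const (suc n) c = trans (cong (λ s → c + s) (∑-const n c)) (lem c (+ n))
  where
  lem : ∀ c m → c + m * c ≡ (1ℤ + m) * c
  lem = solve-∀

∑-** : ∀ {m n} (f : Fin m → ℤ) (g : Fin n → ℤ) → ∑ f * ∑ g ≡ ∑ (λ x → ∑ (λ y → f x * g y))
∑-** f g = trans (sym (∑-*ʳ (∑ g) f)) (∑-cong λ x → sym (∑-*ˡ (f x) g))

∑-0≤-single : ∀ {n} {f : Fin n → ℤ} → (∀ i → 0≤ f i) → ∀ i → 0≤ ∑ f - f i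
∑-0≤-single {suc n} {f} p zero = 0≤-resp (lem (f zero) _) (∑-0≤ (λ i → p (suc i)))
  where
  lem : ∀ x y → (x + y) - x ≡ y
  lem = solve-∀
∑-0≤-single {suc n} {f} p (suc i) =
  0≤-resp (lem (f zero) _ _) (0≤-+ (p zero) (∑-0≤-single (λ i → p (suc i)) i))
  where
  lem : ∀ x y z → (x + y) - z ≡ x + (y - z)
  lem = solve-∀

-- Evaluates to c₁ * F f₁ + (c₂ * F f₂ + … + 0), so ∑-combine distributes ∑ over several terms at once.
combine : ∀ {A : Set} → (A → ℤ) → List (ℤ × A) → ℤ
combine F = foldr (λ (c , f) s → c * F f + s) 0ℤ

∑-combine : ∀ {n} (L : List (ℤ × (Fin n → ℤ))) →
  ∑ (λ x → combine (λ f → f x) L) ≡ combine ∑ L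
∑-combine {n} [] = ∑-zero {n}
∑-combine ((c , f) ∷ L) =
  trans (∑-+ (λ x → c * f x) (λ x → combine (λ f → f x) L)) (cong₂ _+_ (∑-*ˡ c f) (∑-combine L))

∑₂ : ∀ {m n} → (Fin m → Fin n → ℤ) → ℤ
∑₂ f = ∑ λ x → ∑ λ y → f x y

∑₂-cong : ∀ {m n} {f g : Fin m → Fin n → ℤ} → (∀ x y → f x y ≡ g x y) → ∑₂ f ≡ ∑₂ g
∑₂-cong p = ∑-cong λ x → ∑-cong (p x)

∑₂-0≤ : ∀ {m n} {f : Fin m → Fin n → ℤ} → (∀ x y → 0≤ f x y) → 0≤ ∑₂ f
∑₂-0≤ p = ∑-0≤ λ x → ∑-0≤ (p x)

∑₂-combine : ∀ {m n} (L : List (ℤ × (Fin m → Fin n → ℤ))) →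
  ∑₂ (λ x y → combine (λ f → f x y) L) ≡ combine ∑₂ L
∑₂-combine {m} {n} [] = trans (∑-cong {m} λ _ → ∑-zero {n}) (∑-zero {m})
∑₂-combine ((c , f) ∷ L) =
  trans (∑-cong λ x → trans (∑-+ (λ y → c * f x y) (λ y → combine (λ f → f x y) L))
                            (cong (_+ ∑ (λ y → combine (λ f → f x y) L)) (∑-*ˡ c (f x))))
 (trans (∑-+ (λ x → c * ∑ (f x)) (λ x → ∑ (λ y → combine (λ f → f x y) L)))
        (cong₂ _+_ (∑-*ˡ c (λ x → ∑ (f x))) (∑₂-combine L)))

δ : ∀ {n} → Fin n → Fin n → ℤ
δ x y with x Fin.≟ y
... | yes _ = 1ℤ
... | no _ = 0ℤ

δ-refl : ∀ {n} (x : Fin n) → δ x x ≡ 1ℤ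
δ-refl x with x Fin.≟ x
... | yes _ = refl
... | no x≢x = ⊥-elim (x≢x refl)

δ-suc : ∀ {n} (x y : Fin n) → δ (suc x) (suc y) ≡ δ x y
δ-suc x y with x Fin.≟ y
... | yes _ = refl
... | no _ = refl

∑-δ : ∀ {n} (f : Fin n → ℤ) y → ∑ (λ x → δ x y * f x) ≡ f y
∑-δ {suc n} f zero =
  trans (cong₂ _+_ (*-identityˡ (f zero)) (trans (∑-cong λ i → *-zeroˡ (f (suc i))) (∑-zero {n})))
        (+-identityʳ (f zero))
∑-δ {suc n} f (suc y) =
  trans (cong₂ _+_ (*-zeroˡ (f zero))
          (trans (∑-cong λ i → cong (_* f (suc i)) (δ-suc i y)) (∑-δ (λ i → f (suc i)) y)))
        (+-identityˡ (f (suc y)))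

∑-erase : ∀ {n} (f : Fin n → ℤ) x y →
  ∑ (λ u → (1ℤ - δ u x - δ u y) * f u) ≡ ∑ f - f x - f y
∑-erase f x y =
  trans (∑-cong λ u → lem (δ u x) (δ u y) (f u))
 (trans (∑-combine ((1ℤ , f) ∷ (- 1ℤ , (λ u → δ u x * f u)) ∷ (- 1ℤ , (λ u → δ u y * f u)) ∷ []))
 (trans (cong₂ (λ p q → 1ℤ * ∑ f + (- 1ℤ * p + (- 1ℤ * q + 0ℤ))) (∑-δ f x) (∑-δ f y))
        (lem′ (∑ f) (f x) (f y))))
  where
  lem : ∀ p q s → (1ℤ - p - q) * s ≡ 1ℤ * s + (- 1ℤ * (p * s) + (- 1ℤ * (q * s) + 0ℤ))
  lem = solve-∀
  lem′ : ∀ s p q → 1ℤ * s + (- 1ℤ * p + (- 1ℤ * q + 0ℤ)) ≡ s - p - q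
  lem′ = solve-∀

∑-δ₁-erase : ∀ {n} (f : Fin n → ℤ) x → ∑ (λ u → (1ℤ - δ u x) * f u) ≡ ∑ f - f x
∑-δ₁-erase f x =
  trans (∑-cong λ u → lem (δ u x) (f u))
 (trans (∑-combine ((1ℤ , f) ∷ (- 1ℤ , (λ u → δ u x * f u)) ∷ []))
 (trans (cong (λ p → 1ℤ * ∑ f + (- 1ℤ * p + 0ℤ)) (∑-δ f x)) (lem′ (∑ f) (f x))))
  where
  lem : ∀ p s → (1ℤ - p) * s ≡ 1ℤ * s + (- 1ℤ * (p * s) + 0ℤ)
  lem = solve-∀
  lem′ : ∀ s p → 1ℤ * s + (- 1ℤ * p + 0ℤ) ≡ s - p
  lem′ = solve-∀

0≤-1-δ : ∀ {n} (u x : Fin n) → 0≤ 1ℤ - δ u x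
0≤-1-δ u x with u Fin.≟ x
... | yes _ = ≤-refl
... | no _ = 0≤ᵐ 1

0≤-1-δ-δ : ∀ {n} {x y : Fin n} → x ≢ y → ∀ u → 0≤ 1ℤ - δ u x - δ u y
0≤-1-δ-δ {x = x} {y} x≢y u with u Fin.≟ x | u Fin.≟ y
... | yes refl | yes refl = ⊥-elim (x≢y refl)
... | yes _ | no _ = ≤-refl
... | no _ | yes _ = ≤-refl
... | no _ | no _ = 0≤ᵐ 1

∑-∑₂-swap : ∀ {l m n} (f : Fin l → Fin m → Fin n → ℤ) →
  ∑ (λ z → ∑₂ (λ x y → f z x y)) ≡ ∑₂ (λ x y → ∑ (λ z → f z x y))
∑-∑₂-swap f = trans (∑-swap (λ z x → ∑ (λ y → f z x y))) (∑-cong λ x → ∑-swap (λ z y → f z x y))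

∑₂-swap : ∀ {l m n o} (f : Fin l → Fin m → Fin n → Fin o → ℤ) →
  ∑₂ (λ i z → ∑₂ (λ x y → f i z x y)) ≡ ∑₂ (λ x y → ∑₂ (λ i z → f i z x y))
∑₂-swap f = trans (∑-cong λ i → ∑-∑₂-swap (f i)) (∑-∑₂-swap (λ i x y → ∑ (λ z → f i z x y)))

∑₂-*ˡ : ∀ {m n} c (f : Fin m → Fin n → ℤ) → ∑₂ (λ x y → c * f x y) ≡ c * ∑₂ f
∑₂-*ˡ c f = trans (∑-cong λ x → ∑-*ˡ c (f x)) (∑-*ˡ c (λ x → ∑ (f x)))

∑₂-+ : ∀ {m n} (f g : Fin m → Fin n → ℤ) → ∑₂ (λ x y → f x y + g x y) ≡ ∑₂ f + ∑₂ g
∑₂-+ f g = trans (∑-cong λ x → ∑-+ (f x) (g x)) (∑-+ (λ x → ∑ (f x)) (λ x → ∑ (g x)))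

-- Common non-neighbours of pairs from a block of vertices

module _ {n : ℕ} (ε : Fin n → ℤ) (b : Fin n → Fin n → ℤ)
         (0≤ε : ∀ w → 0≤ ε w) (0≤1-ε : ∀ w → 0≤ 1ℤ - ε w) (b-sym : ∀ x y → b x y ≡ b y x) where
  private
    N = + n
    d = ∑ ε
    u = λ x → ∑ (λ w → b x w)
    cb = λ x y → ∑ (λ w → b x w * b y w)
    D = ∑₂ (λ x y → ε x * ε y * b x y)
    M = λ w → ∑ (λ x → ε x * b x w)

    ∑M : ∑ M ≡ ∑ (λ x → ε x * u x)
    ∑M = trans (∑-swap (λ w x → ε x * b x w)) (∑-cong λ x → ∑-*ˡ (ε x) (b x))

    ∑M² : ∑ (λ w → M w * M w) ≡ ∑₂ (λ x y → ε x * ε y * cb x y)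
    ∑M² =
      trans (∑-cong λ w → ∑-** (λ x → ε x * b x w) (λ x → ε x * b x w))
     (trans (∑-swap (λ w x → ∑ (λ y → (ε x * b x w) * (ε y * b y w))))
            (∑-cong λ x →
              trans (∑-swap (λ w y → (ε x * b x w) * (ε y * b y w)))
                    (∑-cong λ y →
                      trans (∑-cong λ w → lem (ε x) (ε y) (b x w) (b y w))
                            (∑-*ˡ (ε x * ε y) (λ w → b x w * b y w)))))
      where
      lem : ∀ p q r s → (p * r) * (q * s) ≡ p * q * (r * s)
      lem = solve-∀

    ∑εM : ∑ (λ w → ε w * M w) ≡ D
    ∑εM = ∑-cong λ w → trans (sym (∑-*ˡ (ε w) (λ x → ε x * b x w)))
                             (∑-cong λ x → trans (lem (ε w) (ε x) (b x w)) (cong (ε w * ε x *_) (b-sym x w)))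
      where
      lem : ∀ p q r → p * (q * r) ≡ p * q * r
      lem = solve-∀

    ∑εε : ∑₂ (λ x y → ε x * ε y) ≡ d * d
    ∑εε = sym (∑-** ε ε)

    ∑εεuˡ : ∑₂ (λ x y → ε x * ε y * u x) ≡ d * ∑ M
    ∑εεuˡ =
      trans (∑₂-cong λ x y → lem (ε x) (ε y) (u x))
     (trans (sym (∑-** (λ x → ε x * u x) ε))
     (trans (cong (_* d) (sym ∑M)) (*-comm (∑ M) d)))
      where
      lem : ∀ p q r → p * q * r ≡ (p * r) * q
      lem = solve-∀

    ∑εεuʳ : ∑₂ (λ x y → ε x * ε y * u y) ≡ d * ∑ M
    ∑εεuʳ =
      trans (∑₂-cong λ x y → *-assoc (ε x) (ε y) (u y))
     (trans (sym (∑-** ε (λ x → ε x * u x))) (cong (d *_) (sym ∑M)))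

  -- Expands 0 ≤ ∑ (1 - ε w) (5 M w - 2 d)², where M w counts the non-neighbours of w in the block ε.
  -- The factor 1 - ε w is what makes the bound strong: a vertex w of a clique ε has M w = 1,
  -- far below the average.
  block-inequality : ∀ k →
    0≤ ∑₂ (λ x y → ε x * ε y * (+ 25 * cb x y - + 10 * (u x + u y) + + 4 * (N - k)))
       + + 4 * (d * d * (k - d)) + + 20 * (d * D)
  block-inequality k = 0≤-resp (trans (cong (λ s → s + + 4 * (d * d * (k - d)) + + 20 * (d * D)) lhs)
      (trans (final d N k (∑ M) (∑ (λ w → M w * M w)) D) (sym squares)))
      (∑-0≤ λ w → 0≤-resp (sq (M w) d (ε w)) (0≤-+ (0≤-* (0≤1-ε w) (0≤-sq (+ 5 * M w - + 2 * d))) (0≤-* (0≤-* (0≤ᵐ 25) (0≤ε w)) (0≤-sq (M w)))))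
    where
    -- A vertex of the block keeps its `25 m²`, so that the squares over all `w` add up to the full
    -- count of common non-neighbours in `∑M²`.
    sq : ∀ m d e →
      + 25 * (m * m) + (- + 20 * d * m + (1ℤ * (+ 4 * (d * d)) + (+ 20 * d * (e * m) + (- + 4 * (d * d) * e + 0ℤ))))
      ≡ (1ℤ - e) * ((+ 5 * m - + 2 * d) * (+ 5 * m - + 2 * d)) + + 25 * e * (m * m)
    sq = solve-∀
    squares : ∑ (λ w → + 25 * (M w * M w) + (- + 20 * d * M w + (1ℤ * (+ 4 * (d * d)) + (+ 20 * d * (ε w * M w) + (- + 4 * (d * d) * ε w + 0ℤ)))))
      ≡ + 25 * ∑ (λ w → M w * M w) + (- + 20 * d * ∑ M + (1ℤ * (N * (+ 4 * (d * d))) + (+ 20 * d * D + (- + 4 * (d * d) * d + 0ℤ))))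
    squares = trans
      (∑-combine ((+ 25 , (λ w → M w * M w)) ∷ (- + 20 * d , M) ∷ (1ℤ , (λ _ → + 4 * (d * d))) ∷ (+ 20 * d , (λ w → ε w * M w)) ∷ (- + 4 * (d * d) , ε) ∷ []))
      (cong₂ (λ p q → + 25 * ∑ (λ w → M w * M w) + (- + 20 * d * ∑ M + (1ℤ * p + (+ 20 * d * q + (- + 4 * (d * d) * d + 0ℤ)))))
        (∑-const n _) ∑εM)
    lhs : ∑₂ (λ x y → ε x * ε y * (+ 25 * cb x y - + 10 * (u x + u y) + + 4 * (N - k)))
      ≡ + 25 * ∑ (λ w → M w * M w) + (- + 10 * (d * ∑ M) + (- + 10 * (d * ∑ M) + (+ 4 * (N - k) * (d * d) + 0ℤ)))
    lhs = trans (∑₂-cong λ x y → lem (ε x * ε y) (cb x y) (u x) (u y) (N - k))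
      (trans (∑₂-combine ((+ 25 , (λ x y → ε x * ε y * cb x y)) ∷ (- + 10 , (λ x y → ε x * ε y * u x)) ∷ (- + 10 , (λ x y → ε x * ε y * u y)) ∷ (+ 4 * (N - k) , (λ x y → ε x * ε y)) ∷ []))
       (cong₂ (λ p q → + 25 * p + q) (sym ∑M²) (cong₂ (λ p q → - + 10 * p + q) ∑εεuˡ
         (cong₂ (λ p q → - + 10 * p + (+ 4 * (N - k) * q + 0ℤ)) ∑εεuʳ ∑εε))))
      where
      lem : ∀ e c p q r → e * (+ 25 * c - + 10 * (p + q) + + 4 * r)
          ≡ + 25 * (e * c) + (- + 10 * (e * p) + (- + 10 * (e * q) + (+ 4 * r * e + 0ℤ)))
      lem = solve-∀
    -- The term `4 d² (k - d)` exchanges the `N - d` vertices outside the block for `N - k`, which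
    -- is the same for all blocks.
    final : ∀ d N k m m² D →
      + 25 * m² + (- + 10 * (d * m) + (- + 10 * (d * m) + (+ 4 * (N - k) * (d * d) + 0ℤ))) + + 4 * (d * d * (k - d)) + + 20 * (d * D)
      ≡ + 25 * m² + (- + 20 * d * m + (1ℤ * (N * (+ 4 * (d * d))) + (+ 20 * d * D + (- + 4 * (d * d) * d + 0ℤ))))
    final = solve-∀

-- Counting in a rainbow-free colouring

-- Classes are integer-valued symmetric indicators, so that every count is a polynomial sum; ordered
-- pairs are counted, whence `+ 2 * k`.
record RainbowFree (N n : ℕ) (k : ℤ) : Set where
  field
    e : Fin N → Fin n → Fin n → ℤ
    e-sym : ∀ i x y → e i x y ≡ e i y x
    e-irrefl : ∀ i x → e i x x ≡ 0ℤ
    palette : ∀ x y → (∀ i → e i x y ≡ 0ℤ) ⊎ (∃[ c ] ∀ i → e i x y ≡ δ i c)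
    size : ∀ i → ∑₂ (e i) ≡ + 2 * k
    no-rainbow : ∀ x y z i j l → e i x y ≡ 1ℤ → e j x z ≡ 1ℤ → e l y z ≡ 1ℤ → i ≡ j ⊎ i ≡ l ⊎ j ≡ l

module Coloured {N n : ℕ} {k : ℤ} (C : RainbowFree N n k) where
  open RainbowFree C

  a b q cb : Fin n → Fin n → ℤ
  a x y = ∑ (λ i → e i x y)
  b x y = 1ℤ - a x y
  q x y = ∑ (λ z → a x z * a y z)
  cb x y = ∑ (λ w → b x w * b y w)

  u : Fin n → ℤ
  u x = ∑ (λ w → b x w)

  d : Fin N → Fin n → ℤ
  d i z = ∑ (λ x → e i x z)

  m hmax : ℤ
  m = + N * k
  hmax = + 9 * + n - + 4 * k

  h : Fin n → Fin n → ℤ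
  h x y = + 25 * cb x y - + 10 * (u x + u y) + + 4 * (+ n - k)

  δ-01 : ∀ {n} (x y : Fin n) → δ x y ≡ 0ℤ ⊎ δ x y ≡ 1ℤ
  δ-01 x y with x Fin.≟ y
  ... | yes _ = inj₂ refl
  ... | no _ = inj₁ refl

  e-01 : ∀ i x y → e i x y ≡ 0ℤ ⊎ e i x y ≡ 1ℤ
  e-01 i x y with palette x y
  ... | inj₁ p = inj₁ (p i)
  ... | inj₂ (c , p) rewrite p i = δ-01 i c

  ∑δ : ∀ {n} (c : Fin n) → ∑ (λ i → δ i c) ≡ 1ℤ
  ∑δ c = trans (∑-cong λ i → sym (*-identityʳ (δ i c))) (∑-δ (λ _ → 1ℤ) c)

  a-01 : ∀ x y → a x y ≡ 0ℤ ⊎ a x y ≡ 1ℤ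
  a-01 x y with palette x y
  ... | inj₁ p = inj₁ (trans (∑-cong p) (∑-zero {N}))
  ... | inj₂ (c , p) = inj₂ (trans (∑-cong p) (∑δ c))

  0≤-01 : ∀ {x} → x ≡ 0ℤ ⊎ x ≡ 1ℤ → 0≤ x
  0≤-01 (inj₁ refl) = ≤-refl
  0≤-01 (inj₂ refl) = 0≤ᵐ 1

  0≤1--01 : ∀ {x} → x ≡ 0ℤ ⊎ x ≡ 1ℤ → 0≤ 1ℤ - x
  0≤1--01 (inj₁ refl) = 0≤ᵐ 1
  0≤1--01 (inj₂ refl) = ≤-refl

  idem-01 : ∀ {x} → x ≡ 0ℤ ⊎ x ≡ 1ℤ → x * x ≡ x
  idem-01 (inj₁ refl) = refl
  idem-01 (inj₂ refl) = refl

  0≤e : ∀ i x y → 0≤ e i x y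
  0≤e i x y = 0≤-01 (e-01 i x y)

  0≤1-e : ∀ i x y → 0≤ 1ℤ - e i x y
  0≤1-e i x y = 0≤1--01 (e-01 i x y)

  0≤a : ∀ x y → 0≤ a x y
  0≤a x y = 0≤-01 (a-01 x y)

  0≤b : ∀ x y → 0≤ b x y
  0≤b x y = 0≤1--01 (a-01 x y)

  a-sym : ∀ x y → a x y ≡ a y x
  a-sym x y = ∑-cong λ i → e-sym i x y

  b-sym : ∀ x y → b x y ≡ b y x
  b-sym x y = cong (λ s → 1ℤ - s) (a-sym x y)

  a-irrefl : ∀ x → a x x ≡ 0ℤ
  a-irrefl x = trans (∑-cong λ i → e-irrefl i x) (∑-zero {N})

  b-refl : ∀ x → b x x ≡ 1ℤ
  b-refl x = cong (λ s → 1ℤ - s) (a-irrefl x)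

  q-eq : ∀ x y → q x y ≡ + n - u x - u y + cb x y
  q-eq x y =
    trans (∑-cong λ z → lem (a x z) (a y z))
   (trans (∑-combine ((1ℤ , (λ z → b x z * b y z)) ∷ (- 1ℤ , b x) ∷ (- 1ℤ , b y) ∷ (1ℤ , (λ _ → 1ℤ)) ∷ []))
   (trans (cong (λ s → 1ℤ * cb x y + (- 1ℤ * u x + (- 1ℤ * u y + (1ℤ * s + 0ℤ)))) (∑-const n 1ℤ))
          (lem′ (cb x y) (u x) (u y) (+ n))))
    where
    lem : ∀ p q → p * q ≡ 1ℤ * ((1ℤ - p) * (1ℤ - q)) + (- 1ℤ * (1ℤ - p) + (- 1ℤ * (1ℤ - q) + (1ℤ * 1ℤ + 0ℤ)))
    lem = solve-∀
    lem′ : ∀ c p q n → 1ℤ * c + (- 1ℤ * p + (- 1ℤ * q + (1ℤ * (n * 1ℤ) + 0ℤ))) ≡ n - p - q + c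
    lem′ = solve-∀

  -- Apart from the constant `- 4 k`, each vertex adds 4, -6 or 9 to `h`, according as it is a
  -- non-neighbour of none, one or both of `x` and `y`.
  h≤hmax : ∀ x y → 0≤ hmax - h x y
  h≤hmax x y = 0≤-resp
    (trans (lem′ (cb x y) (u x) (u y) (+ n) k)
    (trans (cong (λ s → - + 25 * cb x y + (+ 10 * u x + (+ 10 * u y + (+ 5 * s + 0ℤ)))) (sym (∑-const n 1ℤ)))
           (sym (∑-combine ((- + 25 , (λ z → b x z * b y z)) ∷ (+ 10 , b x) ∷ (+ 10 , b y) ∷ (+ 5 , (λ _ → 1ℤ)) ∷ [])))))
    (∑-0≤ λ w → 0≤-resp (lem (b x w) (b y w))
      (0≤-+ (0≤-+ (0≤-* (0≤-* (0≤ᵐ 5) (0≤1-b x w)) (0≤1-b y w)) (0≤-* (0≤-* (0≤ᵐ 15) (0≤b x w)) (0≤1-b y w)))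
            (0≤-* (0≤-* (0≤ᵐ 15) (0≤b y w)) (0≤1-b x w))))
    where
    0≤1-b : ∀ x y → 0≤ 1ℤ - b x y
    0≤1-b x y = 0≤-resp (lem₀ (a x y)) (0≤a x y)
      where
      lem₀ : ∀ p → 1ℤ - (1ℤ - p) ≡ p
      lem₀ = solve-∀
    lem : ∀ p q → - + 25 * (p * q) + (+ 10 * p + (+ 10 * q + (+ 5 * 1ℤ + 0ℤ)))
      ≡ + 5 * (1ℤ - p) * (1ℤ - q) + + 15 * p * (1ℤ - q) + + 15 * q * (1ℤ - p)
    lem = solve-∀
    lem′ : ∀ c p q n k → (+ 9 * n - + 4 * k) - (+ 25 * c - + 10 * (p + q) + + 4 * (n - k))
      ≡ - + 25 * c + (+ 10 * p + (+ 10 * q + (+ 5 * (n * 1ℤ) + 0ℤ)))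
    lem′ = solve-∀

  -- Degrees within one colour class

  d-sym : ∀ i z → ∑ (e i z) ≡ d i z
  d-sym i z = ∑-cong λ x → e-sym i z x

  ∑d : ∀ i → ∑ (d i) ≡ + 2 * k
  ∑d i = trans (∑-swap (λ z x → e i x z)) (size i)

  0≤d : ∀ i z → 0≤ d i z
  0≤d i z = ∑-0≤ λ x → 0≤e i x z

  -- The sum counts, twice, the edges of class `i` that avoid `z`.
  d≤k : ∀ i z → 0≤ k - d i z
  d≤k i z = 0≤-cancel 1 (0≤-resp
    (sym (trans (∑-δ₁-erase (λ x → ∑ (e i x) - e i x z) z)
         (trans (cong₂ (λ p q → p - (∑ (e i z) - q))
                  (trans (∑-cong λ x → lem₁ (∑ (e i x)) (e i x z))
                  (trans (∑-+ (λ x → ∑ (e i x)) (λ x → - 1ℤ * e i x z))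
                         (cong₂ _+_ (size i) (∑-*ˡ (- 1ℤ) (λ x → e i x z)))))
                  (e-irrefl i z))
         (trans (cong (λ s → + 2 * k + - 1ℤ * d i z - (s - 0ℤ)) (d-sym i z)) (lem₂ k (d i z))))))
    (∑-0≤ λ x → 0≤-* (0≤-1-δ x z) (∑-0≤-single (0≤e i x) z)))
    where
    lem₁ : ∀ p q → p - q ≡ p + - 1ℤ * q
    lem₁ = solve-∀
    lem₂ : ∀ k d → + 2 * k + - 1ℤ * d - (d - 0ℤ) ≡ + 2 * (k - d)
    lem₂ = solve-∀

  -- Counts the edges of class i that avoid both ends of the edge xy.
  edge-degrees : ∀ i x y → 0≤ e i x y * (k + 1ℤ - d i x - d i y)
  edge-degrees i x y with e-01 i x y
  ... | inj₁ p = 0≤-resp (trans (cong (_* (k + 1ℤ - d i x - d i y)) p) (*-zeroˡ (k + 1ℤ - d i x - d i y))) ≤-refl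
  ... | inj₂ p = 0≤-resp (trans (cong (_* (k + 1ℤ - d i x - d i y)) p) (*-identityˡ (k + 1ℤ - d i x - d i y)))
    (0≤-cancel 1 (0≤-resp (sym count) (∑-0≤ λ v → 0≤-* (0≤-1-δ-δ x≢y v)
      (0≤-resp (sym (∑-erase (e i v) x y)) (∑-0≤ λ w → 0≤-* (0≤-1-δ-δ x≢y w) (0≤e i v w))))))
    where
    0≢1 : 0ℤ ≢ 1ℤ
    0≢1 ()
    x≢y : x ≢ y
    x≢y refl = 0≢1 (trans (sym (e-irrefl i x)) p)
    outside : Fin n → ℤ
    outside v = ∑ (e i v) - e i v x - e i v y
    lem₁ : ∀ p q r → p - q - r ≡ 1ℤ * p + (- 1ℤ * q + (- 1ℤ * r + 0ℤ))
    lem₁ = solve-∀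
    lem₂ : ∀ k p q → 1ℤ * (+ 2 * k) + (- 1ℤ * p + (- 1ℤ * q + 0ℤ)) - (p - 0ℤ - 1ℤ) - (q - 1ℤ - 0ℤ) ≡ + 2 * (k + 1ℤ - p - q)
    lem₂ = solve-∀
    count : ∑ (λ v → (1ℤ - δ v x - δ v y) * outside v) ≡ + 2 * (k + 1ℤ - d i x - d i y)
    count =
      trans (∑-erase outside x y)
     (trans (cong₂ (λ s t → s - t - outside y)
        (trans (∑-cong λ v → lem₁ (∑ (e i v)) (e i v x) (e i v y))
        (trans (∑-combine ((1ℤ , (λ v → ∑ (e i v))) ∷ (- 1ℤ , (λ v → e i v x)) ∷ (- 1ℤ , (λ v → e i v y)) ∷ []))
               (cong (λ s → 1ℤ * s + (- 1ℤ * d i x + (- 1ℤ * d i y + 0ℤ))) (size i))))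
        (cong₂ (λ s t → s - t - e i x y) (d-sym i x) (e-irrefl i x)))
     (trans (cong (λ t → 1ℤ * (+ 2 * k) + (- 1ℤ * d i x + (- 1ℤ * d i y + 0ℤ)) - (d i x - 0ℤ - e i x y) - t)
              (cong₂ (λ s t → s - e i y x - t) (d-sym i y) (e-irrefl i y)))
     (trans (cong₂ (λ s t → 1ℤ * (+ 2 * k) + (- 1ℤ * d i x + (- 1ℤ * d i y + 0ℤ)) - (d i x - 0ℤ - s) - (d i y - t - 0ℤ))
              p (trans (e-sym i y x) p))
            (lem₂ k (d i x) (d i y)))))

  D : Fin N → Fin n → ℤ
  D i z = ∑₂ (λ x y → e i x z * e i y z * b x y)

  -- The diagonal `x = y` alone contributes `d i z`, because a vertex is its own non-neighbour.
  d≤D : ∀ i z → 0≤ D i z - d i z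
  d≤D i z = 0≤-resp
    (trans (lem (D i z) (d i z))
    (trans (cong (_+ - 1ℤ * d i z) (∑-cong λ x → trans (∑-cong λ y → *-assoc (e i x z) (e i y z) (b x y)) (∑-*ˡ (e i x z) (λ y → e i y z * b x y))))
    (trans (cong (λ s → ∑ (λ x → e i x z * ∑ (λ y → e i y z * b x y)) + s) (sym (∑-*ˡ (- 1ℤ) (λ x → e i x z))))
    (trans (sym (∑-+ (λ x → e i x z * ∑ (λ y → e i y z * b x y)) (λ x → - 1ℤ * e i x z)))
           (∑-cong λ x → trans (cong (λ s → e i x z * ∑ (λ y → e i y z * b x y) + - 1ℤ * s) (sym (idem-01 (e-01 i x z))))
                        (trans (lem₂ (e i x z) (∑ (λ y → e i y z * b x y)))
                               (cong (λ s → e i x z * (∑ (λ y → e i y z * b x y) - e i x z * s)) (sym (b-refl x)))))))))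
    (∑-0≤ λ x → 0≤-* (0≤e i x z) (∑-0≤-single (λ y → 0≤-* (0≤e i y z) (0≤b x y)) x))
    where
    lem : ∀ p q → p - q ≡ p + - 1ℤ * q
    lem = solve-∀
    lem₂ : ∀ p s → p * s + - 1ℤ * (p * p) ≡ p * (s - p * 1ℤ)
    lem₂ = solve-∀

  -- This is `block-inequality` for the neighbours of `z` in colour `i`. Its term `20 d D` is
  -- weakened to `20 d² + 20 k (D - d)`, where `D` has a coefficient independent of `i` and `z` and
  -- can be summed.
  star : ∀ i z → 0≤ ∑₂ (λ x y → e i x z * e i y z * h x y)
    + + 4 * (d i z * d i z * (k - d i z)) + + 20 * (d i z * d i z) + + 20 * (k * (D i z - d i z))
  star i z = 0≤-resp (lem (∑₂ (λ x y → e i x z * e i y z * h x y)) (d i z) (D i z) k)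
    (0≤-+ (block-inequality (λ x → e i x z) b (λ x → 0≤e i x z) (λ x → 0≤1-e i x z) b-sym k)
          (0≤-* (0≤ᵐ 20) (0≤-* (d≤k i z) (d≤D i z))))
    where
    lem : ∀ s d D k → s + + 4 * (d * d * (k - d)) + + 20 * (d * d) + + 20 * (k * (D - d))
      ≡ (s + + 4 * (d * d * (k - d)) + + 20 * (d * D)) + + 20 * ((k - d) * (D - d))
    lem = solve-∀

  d² : Fin N → ℤ
  d² i = ∑ (λ z → d i z * d i z)

  -- For an edge zx of class i, k - d z is at most d x plus the defect k + 1 - d z - d x of edge-degrees.
  cubes : ∀ i → 0≤ k * (+ 2 * k * (k + 1ℤ) - + 2 * d² i) + + 4 * (k * k) - ∑ (λ z → d i z * d i z * (k - d i z))
  cubes i = 0≤-resp (sym eq) (∑₂-0≤ λ z x → 0≤-resp (lem (e i x z) (d i z) (d i x) k)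
      (0≤-+ (0≤-+ (0≤-* (d≤k i z) (0≤-resp (cong (e i x z *_) (lem₀ k (d i x) (d i z))) (edge-degrees i x z)))
                  (0≤-* (0≤1-e i x z) (0≤-* (0≤d i z) (0≤d i x))))
            (0≤-* (0≤e i x z) (0≤d i z))))
    where
    lem₀ : ∀ k p q → k + 1ℤ - q - p ≡ k + 1ℤ - p - q
    lem₀ = solve-∀
    lem : ∀ e z x k → k * (k + 1ℤ) * e + (- k * (e * z) + (- k * (e * x) + (1ℤ * (z * x) + (- 1ℤ * (e * (z * (k - z))) + 0ℤ))))
      ≡ (k - z) * (e * (k + 1ℤ - z - x)) + (1ℤ - e) * (z * x) + e * z
    lem = solve-∀
    row : ∀ (f : Fin n → ℤ) → ∑₂ (λ z x → e i x z * f z) ≡ ∑ (λ z → d i z * f z)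
    row f = ∑-cong λ z → ∑-*ʳ (f z) (λ x → e i x z)
    column : ∑₂ (λ z x → e i x z * d i x) ≡ d² i
    column = trans (∑-swap (λ z x → e i x z * d i x))
                (∑-cong λ x → trans (∑-*ʳ (d i x) (λ z → e i x z)) (cong (_* d i x) (d-sym i x)))
    eq : _ ≡ _
    eq = trans
      (∑₂-combine ((k * (k + 1ℤ) , (λ z x → e i x z)) ∷ (- k , (λ z x → e i x z * d i z)) ∷ (- k , (λ z x → e i x z * d i x))
        ∷ (1ℤ , (λ z x → d i z * d i x)) ∷ (- 1ℤ , (λ z x → e i x z * (d i z * (k - d i z)))) ∷ []))
      (trans (cong₂ (λ s t → k * (k + 1ℤ) * s + t) (∑d i)
        (cong₂ (λ s t → - k * s + t) (row (d i))
        (cong₂ (λ s t → - k * s + t) column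
        (cong₂ (λ s t → 1ℤ * s + (- 1ℤ * t + 0ℤ)) (trans (sym (∑-** (d i) (d i))) (cong₂ _*_ (∑d i) (∑d i)))
           (trans (row (λ z → d i z * (k - d i z))) (∑-cong λ z → sym (*-assoc (d i z) (d i z) (k - d i z))))))))
        (lem′ k (d² i) (∑ (λ z → d i z * d i z * (k - d i z)))))
      where
      lem′ : ∀ k s t → k * (k + 1ℤ) * (+ 2 * k) + (- k * s + (- k * s + (1ℤ * (+ 2 * k * (+ 2 * k)) + (- 1ℤ * t + 0ℤ))))
        ≡ k * (+ 2 * k * (k + 1ℤ) - + 2 * s) + + 4 * (k * k) - t
      lem′ = solve-∀

  -- Triangles and monochromatic cherries over a pair

  λ-term μ-term : Fin n → Fin n → Fin N → Fin n → ℤ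
  λ-term x y i z = e i x z * e i y z * (a x y - e i x y)
  -- Inclusion and exclusion over the two ends: a monochromatic triangle counts once here and not at
  -- all in `λ-term`.
  μ-term x y i z = e i x y * (e i x z * a y z + a x z * e i y z - e i x z * e i y z)

  coloured-a : ∀ {x y c} → (∀ i → e i x y ≡ δ i c) → a x y ≡ 1ℤ
  coloured-a {c = c} p = trans (∑-cong p) (∑δ c)

  uncoloured-a : ∀ {x y} → (∀ i → e i x y ≡ 0ℤ) → a x y ≡ 0ℤ
  uncoloured-a p = trans (∑-cong p) (∑-zero {N})

  ∑-0≡ : ∀ {n} {f : Fin n → ℤ} → (∀ i → f i ≡ 0ℤ) → 0ℤ ≡ ∑ f
  ∑-0≡ {n} p = sym (trans (∑-cong p) (∑-zero {n}))

  -- A common neighbour z of the edge xy either sees x and y in one colour different from that of xy,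
  -- or is joined to x or to y in the colour of xy.
  triangle : ∀ x y z → a x y * (a x z * a y z) ≡ ∑ (λ i → λ-term x y i z) + ∑ (λ i → μ-term x y i z)
  triangle x y z with palette x y | palette x z | palette y z
  ... | inj₁ p | _ | _ =
    trans (cong (_* (a x z * a y z)) (uncoloured-a p))
   (trans (*-zeroˡ (a x z * a y z))
          (cong₂ _+_
            (∑-0≡ λ i → trans (cong₂ (λ s t → e i x z * e i y z * (s - t)) (uncoloured-a p) (p i)) (*-zeroʳ (e i x z * e i y z)))
            (∑-0≡ λ i → trans (cong (_* (e i x z * a y z + a x z * e i y z - e i x z * e i y z)) (p i)) (*-zeroˡ (e i x z * a y z + a x z * e i y z - e i x z * e i y z)))))
  ... | inj₂ _ | inj₁ p | _ =
    trans (cong (λ s → a x y * (s * a y z)) (uncoloured-a p))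
   (trans (lem₀ (a x y) (a y z))
          (cong₂ _+_
            (∑-0≡ λ i → trans (cong (λ s → s * e i y z * (a x y - e i x y)) (p i)) (lem₁ (e i y z) (a x y - e i x y)))
            (∑-0≡ λ i → trans (cong₂ (λ s t → e i x y * (s * a y z + t * e i y z - s * e i y z)) (p i) (uncoloured-a p)) (lem₂ (e i x y) (a y z) (e i y z)))))
    where
    lem₀ : ∀ p q → p * (0ℤ * q) ≡ 0ℤ + 0ℤ
    lem₀ = solve-∀
    lem₁ : ∀ p q → 0ℤ * p * q ≡ 0ℤ
    lem₁ = solve-∀
    lem₂ : ∀ p q r → p * (0ℤ * q + 0ℤ * r - 0ℤ * r) ≡ 0ℤ
    lem₂ = solve-∀
  ... | inj₂ _ | inj₂ _ | inj₁ p =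
    trans (cong (λ s → a x y * (a x z * s)) (uncoloured-a p))
   (trans (lem₀ (a x y) (a x z))
          (cong₂ _+_
            (∑-0≡ λ i → trans (cong (λ s → e i x z * s * (a x y - e i x y)) (p i)) (lem₁ (e i x z) (a x y - e i x y)))
            (∑-0≡ λ i → trans (cong₂ (λ s t → e i x y * (e i x z * t + a x z * s - e i x z * s)) (p i) (uncoloured-a p)) (lem₂ (e i x y) (e i x z) (a x z)))))
    where
    lem₀ : ∀ p q → p * (q * 0ℤ) ≡ 0ℤ + 0ℤ
    lem₀ = solve-∀
    lem₁ : ∀ p q → p * 0ℤ * q ≡ 0ℤ
    lem₁ = solve-∀
    lem₂ : ∀ p q r → p * (q * 0ℤ + r * 0ℤ - q * 0ℤ) ≡ 0ℤ
    lem₂ = solve-∀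
  ... | inj₂ (c₁ , p₁) | inj₂ (c₂ , p₂) | inj₂ (c₃ , p₃) =
    trans (cong₂ _*_ (coloured-a p₁) (cong₂ _*_ (coloured-a p₂) (coloured-a p₃)))
   (trans (sym (value (no-rainbow x y z c₁ c₂ c₃ (trans (p₁ c₁) (δ-refl c₁)) (trans (p₂ c₂) (δ-refl c₂)) (trans (p₃ c₃) (δ-refl c₃)))))
          (sym (cong₂ _+_
            (trans (∑-cong λ i → trans (cong₂ (λ s t → s * t * (a x y - e i x y)) (p₂ i) (p₃ i))
                               (trans (cong₂ (λ s t → δ i c₂ * δ i c₃ * (s - t)) (coloured-a p₁) (p₁ i)) (*-assoc (δ i c₂) (δ i c₃) (1ℤ - δ i c₁))))
                   (∑-δ (λ i → δ i c₃ * (1ℤ - δ i c₁)) c₂))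
            (trans (∑-cong λ i → cong₂ _*_ (p₁ i) (cong₂ (λ s t → s - t)
                      (cong₂ _+_ (cong₂ _*_ (p₂ i) (coloured-a p₃)) (cong₂ _*_ (coloured-a p₂) (p₃ i)))
                      (cong₂ _*_ (p₂ i) (p₃ i))))
                   (∑-δ (λ i → δ i c₂ * 1ℤ + 1ℤ * δ i c₃ - δ i c₂ * δ i c₃) c₁)))))
    where
    value : c₁ ≡ c₂ ⊎ c₁ ≡ c₃ ⊎ c₂ ≡ c₃ →
      δ c₂ c₃ * (1ℤ - δ c₂ c₁) + (δ c₁ c₂ * 1ℤ + 1ℤ * δ c₁ c₃ - δ c₁ c₂ * δ c₁ c₃) ≡ 1ℤ
    value (inj₁ refl) rewrite δ-refl c₁ = lem (δ c₁ c₃)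
      where
      lem : ∀ p → p * (1ℤ - 1ℤ) + (1ℤ * 1ℤ + 1ℤ * p - 1ℤ * p) ≡ 1ℤ
      lem = solve-∀
    value (inj₂ (inj₁ refl)) rewrite δ-refl c₁ = lem (δ c₂ c₁) (δ c₁ c₂) (idem-01 (δ-01 c₂ c₁))
      where
      lem₀ : ∀ p q → p * (1ℤ - p) + (q * 1ℤ + 1ℤ * 1ℤ - q * 1ℤ) ≡ 1ℤ + (p - p * p)
      lem₀ = solve-∀
      lem₁ : ∀ p → 1ℤ + (p - p) ≡ 1ℤ
      lem₁ = solve-∀
      lem : ∀ p q → p * p ≡ p → p * (1ℤ - p) + (q * 1ℤ + 1ℤ * 1ℤ - q * 1ℤ) ≡ 1ℤ
      lem p q r = trans (lem₀ p q) (trans (cong (λ s → 1ℤ + (p - s)) r) (lem₁ p))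
    value (inj₂ (inj₂ refl)) with c₁ Fin.≟ c₂ | c₂ Fin.≟ c₁ | c₂ Fin.≟ c₂
    ... | yes _ | yes _ | yes _ = refl
    ... | no _ | no _ | yes _ = refl
    ... | yes refl | no ≢ | _ = ⊥-elim (≢ refl)
    ... | no ≢ | yes refl | _ = ⊥-elim (≢ refl)
    ... | _ | _ | no ≢ = ⊥-elim (≢ refl)

  -- Monochromatic cherries with ends `x` and `y`: those closed by an edge (`p`), open or degenerate
  -- ones (`t`), those inside a monochromatic triangle (`r`), and all of them (`S₂`).
  p t r μ S₂ : Fin n → Fin n → ℤ
  p x y = ∑₂ (λ i z → e i x z * e i y z * a x y)
  t x y = ∑₂ (λ i z → e i x z * e i y z * b x y)
  r x y = ∑₂ (λ i z → e i x z * e i y z * e i x y)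
  μ x y = ∑₂ (λ i z → μ-term x y i z)
  S₂ x y = ∑₂ (λ i z → e i x z * e i y z)

  S₂-eq : ∀ x y → S₂ x y ≡ p x y + t x y
  S₂-eq x y = trans (∑₂-cong λ i z → lem (e i x z * e i y z) (a x y))
    (∑₂-+ (λ i z → e i x z * e i y z * a x y) (λ i z → e i x z * e i y z * b x y))
    where
    lem : ∀ p q → p ≡ p * q + p * (1ℤ - q)
    lem = solve-∀

  aq-eq : ∀ x y → a x y * q x y ≡ p x y - r x y + μ x y
  aq-eq x y =
    trans (sym (∑-*ˡ (a x y) (λ z → a x z * a y z)))
   (trans (∑-cong (triangle x y))
   (trans (∑-+ (λ z → ∑ (λ i → λ-term x y i z)) (λ z → ∑ (λ i → μ-term x y i z)))
          (cong₂ _+_ (trans (∑-swap (λ z i → λ-term x y i z)) split) (∑-swap (λ z i → μ-term x y i z)))))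
    where
    lem : ∀ p q r → p * (q - r) ≡ 1ℤ * (p * q) + (- 1ℤ * (p * r) + 0ℤ)
    lem = solve-∀
    lem′ : ∀ p q → 1ℤ * p + (- 1ℤ * q + 0ℤ) ≡ p - q
    lem′ = solve-∀
    split : ∑₂ (λ i z → λ-term x y i z) ≡ p x y - r x y
    split = trans (∑₂-cong λ i z → lem (e i x z * e i y z) (a x y) (e i x y))
      (trans (∑₂-combine ((1ℤ , (λ i z → e i x z * e i y z * a x y)) ∷ (- 1ℤ , (λ i z → e i x z * e i y z * e i x y)) ∷ []))
             (lem′ (p x y) (r x y)))

  -- Within its colour an edge has degree sum at most `k + 1`. Two of these incidences are the edge
  -- itself, seen from either end; they are absorbed by `A` and `B`, since `y` and `x` are
  -- non-neighbours of themselves, and this leaves `k - 1`.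
  μ-bound : ∀ x y → 0≤ (k - 1ℤ) * a x y - μ x y
  μ-bound x y = 0≤-resp
    (trans (lem₀ ((k - 1ℤ) * a x y) (μ x y))
    (trans (cong₂ _+_ (sym (∑-*ˡ (k - 1ℤ) (λ i → e i x y))) (sym (∑-*ˡ (- 1ℤ) (λ i → ∑ (μ-term x y i)))))
           (sym (∑-+ (λ i → (k - 1ℤ) * e i x y) (λ i → - 1ℤ * ∑ (μ-term x y i))))))
    (∑-0≤ λ i → 0≤-resp (per-colour i)
      (0≤-+ (0≤-+ (0≤-+ (edge-degrees i x y) (0≤-* (0≤e i x y) (0≤A i))) (0≤-* (0≤e i x y) (0≤B i)))
            (0≤-* (0≤e i x y) (∑-0≤ λ z → 0≤-* (0≤e i x z) (0≤e i y z)))))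
    where
    A B : Fin N → ℤ
    A i = ∑ (λ z → e i x z * b y z)
    B i = ∑ (λ z → b x z * e i y z)
    0≤A : ∀ i → 0≤ A i - e i x y
    0≤A i = 0≤-resp (cong (λ s → A i - s) (trans (sym (*-identityʳ (e i x y))) (cong (e i x y *_) (sym (b-refl y)))))
                    (∑-0≤-single (λ z → 0≤-* (0≤e i x z) (0≤b y z)) y)
    0≤B : ∀ i → 0≤ B i - e i x y
    0≤B i = 0≤-resp (cong (λ s → B i - s) (trans (e-sym i x y) (trans (sym (*-identityˡ (e i y x))) (cong (_* e i y x) (sym (b-refl x))))))
                    (∑-0≤-single (λ z → 0≤-* (0≤b x z) (0≤e i y z)) x)
    lem₀ : ∀ p q → p - q ≡ p + - 1ℤ * q
    lem₀ = solve-∀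
    lem₁ : ∀ e p q r s → e * (p * (1ℤ - r) + (1ℤ - s) * q - p * q)
      ≡ e * p + (e * q + (- e * (p * r) + (- e * (s * q) + (- e * (p * q) + 0ℤ))))
    lem₁ = solve-∀
    lem₂ : ∀ p → p ≡ 1ℤ - (1ℤ - p)
    lem₂ = solve-∀
    expand : ∀ i → ∑ (μ-term x y i) ≡ e i x y * d i x + (e i x y * d i y + (- e i x y * A i + (- e i x y * B i + (- e i x y * ∑ (λ z → e i x z * e i y z) + 0ℤ))))
    expand i = trans
      (∑-cong λ z → trans (cong₂ (λ s t → e i x y * (e i x z * s + t * e i y z - e i x z * e i y z)) (lem₂ (a y z)) (lem₂ (a x z)))
                          (lem₁ (e i x y) (e i x z) (e i y z) (b y z) (b x z)))
      (trans (∑-combine ((e i x y , e i x) ∷ (e i x y , e i y) ∷ (- e i x y , (λ z → e i x z * b y z)) ∷ (- e i x y , (λ z → b x z * e i y z)) ∷ (- e i x y , (λ z → e i x z * e i y z)) ∷ []))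
             (cong₂ (λ s t → e i x y * s + (e i x y * t + (- e i x y * A i + (- e i x y * B i + (- e i x y * ∑ (λ z → e i x z * e i y z) + 0ℤ))))) (d-sym i x) (d-sym i y)))
    lem₃ : ∀ k e p q A B C →
      (k - 1ℤ) * e + - 1ℤ * (e * p + (e * q + (- e * A + (- e * B + (- e * C + 0ℤ)))))
      ≡ e * (k + 1ℤ - p - q) + e * (A - e) + e * (B - e) + e * C + + 2 * (e * e - e)
    lem₃ = solve-∀
    lem₄ : ∀ w e → w + + 2 * (e - e) ≡ w
    lem₄ = solve-∀
    per-colour : ∀ i → (k - 1ℤ) * e i x y + - 1ℤ * ∑ (μ-term x y i)
      ≡ e i x y * (k + 1ℤ - d i x - d i y) + e i x y * (A i - e i x y) + e i x y * (B i - e i x y) + e i x y * ∑ (λ z → e i x z * e i y z)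
    per-colour i =
      trans (cong (λ s → (k - 1ℤ) * e i x y + - 1ℤ * s) (expand i))
     (trans (lem₃ k (e i x y) (d i x) (d i y) (A i) (B i) (∑ (λ z → e i x z * e i y z)))
     (trans (cong (λ s → e i x y * (k + 1ℤ - d i x - d i y) + e i x y * (A i - e i x y) + e i x y * (B i - e i x y) + e i x y * ∑ (λ z → e i x z * e i y z) + + 2 * (s - e i x y)) (idem-01 (e-01 i x y)))
            (lem₄ _ (e i x y))))

  -- Sums over all pairs of vertices

  P O R X H AQ : ℤ
  P = ∑₂ p
  O = ∑₂ t
  R = ∑₂ r
  X = ∑₂ (λ x y → a x y * (q x y - (k - 1ℤ)) * h x y)
  H = ∑₂ (λ x y → S₂ x y * h x y)
  AQ = ∑₂ (λ x y → a x y * q x y)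

  ∑a : ∑₂ a ≡ + 2 * m
  ∑a = trans (sym (∑-∑₂-swap e)) (trans (∑-cong size) (trans (∑-const N (+ 2 * k)) (lem (+ N) k)))
    where
    lem : ∀ N k → N * (+ 2 * k) ≡ + 2 * (N * k)
    lem = solve-∀

  -- Both products in `μ-term` are closed cherries centred at an end of `xy`, so renaming the
  -- vertices turns each into `P`.
  ∑μ : ∑₂ μ ≡ + 2 * P - R
  ∑μ =
    trans (∑₂-cong λ x y → trans (∑₂-cong λ i z → lem (e i x y) (e i x z) (a y z) (a x z) (e i y z))
            (∑₂-combine ((1ℤ , (λ i z → e i x y * e i x z * a y z)) ∷ (1ℤ , (λ i z → e i x y * e i y z * a x z)) ∷ (- 1ℤ , (λ i z → e i x z * e i y z * e i x y)) ∷ [])))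
   (trans (∑₂-combine ((1ℤ , (λ x y → ∑₂ (λ i z → e i x y * e i x z * a y z))) ∷ (1ℤ , (λ x y → ∑₂ (λ i z → e i x y * e i y z * a x z))) ∷ (- 1ℤ , r) ∷ []))
   (trans (cong₂ (λ f g → 1ℤ * f + (1ℤ * g + (- 1ℤ * R + 0ℤ))) at-x at-y) (lem′ P R)))
    where
    lem : ∀ e f p q g → e * (f * p + q * g - f * g) ≡ 1ℤ * (e * f * p) + (1ℤ * (e * g * q) + (- 1ℤ * (f * g * e) + 0ℤ))
    lem = solve-∀
    lem′ : ∀ p q → 1ℤ * p + (1ℤ * p + (- 1ℤ * q + 0ℤ)) ≡ + 2 * p - q
    lem′ = solve-∀
    at-x : ∑₂ (λ x y → ∑₂ (λ i z → e i x y * e i x z * a y z)) ≡ P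
    at-x =
      trans (∑-swap (λ x y → ∑₂ (λ i z → e i x y * e i x z * a y z)))
            (∑-cong λ y →
              trans (∑-∑₂-swap (λ x i z → e i x y * e i x z * a y z))
             (trans (∑-swap (λ i z → ∑ (λ x → e i x y * e i x z * a y z)))
                    (∑-cong λ z → ∑₂-cong λ i x → cong (_* a y z) (cong₂ _*_ (e-sym i x y) (e-sym i x z)))))
    at-y : ∑₂ (λ x y → ∑₂ (λ i z → e i x y * e i y z * a x z)) ≡ P
    at-y = ∑-cong λ x →
      trans (∑-∑₂-swap (λ y i z → e i x y * e i y z * a x z))
     (trans (∑-swap (λ i z → ∑ (λ y → e i x y * e i y z * a x z)))
            (∑-cong λ z → ∑₂-cong λ i y → cong (λ s → e i x y * s * a x z) (e-sym i y z)))

  -- A triangle with exactly two edges of one colour contains one monochromatic cherry, a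
  -- monochromatic triangle three; `R` corrects the excess.
  AQ-eq : AQ ≡ + 3 * P - + 2 * R
  AQ-eq =
    trans (∑₂-cong λ x y → trans (aq-eq x y) (lem (p x y) (r x y) (μ x y)))
   (trans (∑₂-combine ((1ℤ , p) ∷ (- 1ℤ , r) ∷ (1ℤ , μ) ∷ []))
   (trans (cong (λ s → 1ℤ * P + (- 1ℤ * R + (1ℤ * s + 0ℤ))) ∑μ) (lem′ P R)))
    where
    lem : ∀ p r μ → p - r + μ ≡ 1ℤ * p + (- 1ℤ * r + (1ℤ * μ + 0ℤ))
    lem = solve-∀
    lem′ : ∀ p r → 1ℤ * p + (- 1ℤ * r + (1ℤ * (+ 2 * p - r) + 0ℤ)) ≡ + 3 * p - + 2 * r
    lem′ = solve-∀

  O-eq : O ≡ ∑₂ D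
  O-eq = sym (∑₂-swap (λ i z x y → e i x z * e i y z * b x y))

  ∑d² : ∑ d² ≡ P + O
  ∑d² =
    trans (∑₂-cong λ i z → ∑-** (λ x → e i x z) (λ x → e i x z))
   (trans (∑₂-swap (λ i z x y → e i x z * e i y z))
   (trans (∑₂-cong S₂-eq) (∑₂-+ p t)))

  H-eq : H ≡ ∑₂ (λ i z → ∑₂ (λ x y → e i x z * e i y z * h x y))
  H-eq = trans (∑₂-cong λ x y → trans (*-comm (S₂ x y) (h x y)) (trans (sym (∑₂-*ˡ (h x y) (λ i z → e i x z * e i y z)))
                                   (∑₂-cong λ i z → *-comm (h x y) (e i x z * e i y z))))
               (sym (∑₂-swap (λ i z x y → e i x z * e i y z * h x y)))

  -- The degenerate cherries already number `2 m`; the difference counts the genuinely open ones.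
  open-pairs : 0≤ O - + 2 * m
  open-pairs = 0≤-resp eq (∑₂-0≤ d≤D)
    where
    lem : ∀ p q → p - q ≡ 1ℤ * p + (- 1ℤ * q + 0ℤ)
    lem = solve-∀
    lem′ : ∀ N k → N * (+ 2 * k) ≡ + 2 * (N * k)
    lem′ = solve-∀
    eq : O - + 2 * m ≡ ∑₂ (λ i z → D i z - d i z)
    eq = trans (cong₂ _-_ O-eq (sym (trans (∑-cong ∑d) (trans (∑-const N (+ 2 * k)) (lem′ (+ N) k)))))
        (trans (lem (∑₂ D) (∑₂ d)) (trans (sym (∑₂-combine ((1ℤ , D) ∷ (- 1ℤ , d) ∷ []))) (∑₂-cong λ i z → sym (lem (D i z) (d i z)))))

  0≤R : 0≤ R
  0≤R = ∑₂-0≤ λ x y → ∑₂-0≤ λ i z → 0≤-* (0≤-* (0≤e i x z) (0≤e i y z)) (0≤e i x y)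

  0≤t : ∀ x y → 0≤ t x y
  0≤t x y = ∑₂-0≤ λ i z → 0≤-* (0≤-* (0≤e i x z) (0≤e i y z)) (0≤b x y)

  0≤r : ∀ x y → 0≤ r x y
  0≤r x y = ∑₂-0≤ λ i z → 0≤-* (0≤-* (0≤e i x z) (0≤e i y z)) (0≤e i x y)

  -- Summing `edge-degrees` over a class counts its pairs of disjoint edges, so the defect vanishes
  -- when every class is a star.
  disjoint-pairs : 0≤ m * (k + 1ℤ) - (P + O)
  disjoint-pairs = 0≤-cancel 1 (0≤-resp eq (∑-0≤ λ i → ∑₂-0≤ (edge-degrees i)))
    where
    lem : ∀ e k x y → e * (k + 1ℤ - x - y) ≡ (k + 1ℤ) * e + (- 1ℤ * (e * x) + (- 1ℤ * (e * y) + 0ℤ))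
    lem = solve-∀
    per-colour : ∀ i → ∑₂ (λ x y → e i x y * (k + 1ℤ - d i x - d i y)) ≡ + 2 * (k * (k + 1ℤ)) * 1ℤ + - + 2 * d² i
    per-colour i =
      trans (∑₂-cong λ x y → lem (e i x y) k (d i x) (d i y))
     (trans (∑₂-combine ((k + 1ℤ , e i) ∷ (- 1ℤ , (λ x y → e i x y * d i x)) ∷ (- 1ℤ , (λ x y → e i x y * d i y)) ∷ []))
     (trans (cong₂ (λ s t → (k + 1ℤ) * s + t) (size i) (cong₂ (λ s t → - 1ℤ * s + (- 1ℤ * t + 0ℤ))
              (∑-cong λ x → trans (∑-*ʳ (d i x) (e i x)) (cong (_* d i x) (d-sym i x)))
              (trans (∑-swap (λ x y → e i x y * d i y)) (∑-cong λ y → ∑-*ʳ (d i y) (λ x → e i x y)))))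
            (lem′ k (d² i))))
      where
      lem′ : ∀ k s → (k + 1ℤ) * (+ 2 * k) + (- 1ℤ * s + (- 1ℤ * s + 0ℤ)) ≡ + 2 * (k * (k + 1ℤ)) * 1ℤ + - + 2 * s
      lem′ = solve-∀
    eq : + 2 * (m * (k + 1ℤ) - (P + O)) ≡ ∑ (λ i → ∑₂ (λ x y → e i x y * (k + 1ℤ - d i x - d i y)))
    eq = sym (trans (∑-cong per-colour)
             (trans (∑-+ (λ i → + 2 * (k * (k + 1ℤ)) * 1ℤ) (λ i → - + 2 * d² i))
             (trans (cong₂ _+_ (∑-const N (+ 2 * (k * (k + 1ℤ)) * 1ℤ)) (trans (∑-*ˡ (- + 2) d²) (cong (- + 2 *_) ∑d²)))
                    (lem′ (+ N) k (P + O)))))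
      where
      lem′ : ∀ N k s → N * (+ 2 * (k * (k + 1ℤ)) * 1ℤ) + - + 2 * s ≡ + 2 * (N * k * (k + 1ℤ) - s)
      lem′ = solve-∀

  Y : ℤ
  Y = ∑₂ (λ i z → d i z * d i z * (k - d i z))

  ∑cubes : 0≤ + 2 * k * (m * (k + 1ℤ)) - + 2 * k * (P + O) + + 4 * (k * m) - Y
  ∑cubes = 0≤-resp eq (∑-0≤ cubes)
    where
    lem : ∀ k s y → k * (+ 2 * k * (k + 1ℤ) - + 2 * s) + + 4 * (k * k) - y
      ≡ 1ℤ * (+ 2 * k * k * (k + 1ℤ) + + 4 * (k * k)) + (- (+ 2 * k) * s + (- 1ℤ * y + 0ℤ))
    lem = solve-∀
    lem′ : ∀ N k s y → + 2 * k * (N * k * (k + 1ℤ)) - + 2 * k * s + + 4 * (k * (N * k)) - y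
      ≡ 1ℤ * (N * (+ 2 * k * k * (k + 1ℤ) + + 4 * (k * k))) + (- (+ 2 * k) * s + (- 1ℤ * y + 0ℤ))
    lem′ = solve-∀
    eq = trans (lem′ (+ N) k (P + O) Y)
        (trans (cong₂ (λ s t → 1ℤ * s + (- (+ 2 * k) * t + (- 1ℤ * Y + 0ℤ))) (sym (∑-const N (+ 2 * k * k * (k + 1ℤ) + + 4 * (k * k)))) (sym ∑d²))
        (trans (sym (∑-combine ((1ℤ , (λ i → + 2 * k * k * (k + 1ℤ) + + 4 * (k * k))) ∷ (- (+ 2 * k) , d²) ∷ (- 1ℤ , (λ i → ∑ (λ z → d i z * d i z * (k - d i z)))) ∷ [])))
               (∑-cong λ i → sym (lem k (d² i) (∑ (λ z → d i z * d i z * (k - d i z)))))))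

  ∑star : 0≤ H + + 4 * Y + + 20 * (P + O) + + 20 * (k * (O - + 2 * m))
  ∑star = 0≤-resp eq (∑₂-0≤ star)
    where
    lem : ∀ s y d D k → s + + 4 * y + + 20 * (d * d) + + 20 * (k * (D - d))
      ≡ 1ℤ * s + (+ 4 * y + (+ 20 * (d * d) + (+ 20 * k * D + (- (+ 20 * k) * d + 0ℤ))))
    lem = solve-∀
    lem′ : ∀ h y s t k N → h + + 4 * y + + 20 * s + + 20 * (k * (t - + 2 * (N * k)))
      ≡ 1ℤ * h + (+ 4 * y + (+ 20 * s + (+ 20 * k * t + (- (+ 20 * k) * (N * (+ 2 * k)) + 0ℤ))))
    lem′ = solve-∀
    eq = trans (lem′ H Y (P + O) O k (+ N))
        (trans (cong₂ (λ s t → 1ℤ * s + (+ 4 * Y + t)) H-eq (cong₂ (λ s t → + 20 * s + t) (sym ∑d²)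
               (cong₂ (λ s t → + 20 * k * s + (- (+ 20 * k) * t + 0ℤ)) O-eq (sym (trans (∑-cong ∑d) (∑-const N (+ 2 * k)))))))
        (trans (sym (∑₂-combine ((1ℤ , (λ i z → ∑₂ (λ x y → e i x z * e i y z * h x y))) ∷ (+ 4 , (λ i z → d i z * d i z * (k - d i z)))
                  ∷ (+ 20 , (λ i z → d i z * d i z)) ∷ (+ 20 * k , D) ∷ (- (+ 20 * k) , d) ∷ [])))
               (∑₂-cong λ i z → sym (lem (∑₂ (λ x y → e i x z * e i y z * h x y)) (d i z * d i z * (k - d i z)) (d i z) (D i z) k))))

  -- By `aq-eq`, `S₂` exceeds `a (q - (k - 1))` by `(k - 1) a - μ + t + r`. Each part of this excess
  -- is nonnegative, so its weight `h` may be replaced by `hmax`.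
  H≤X : 0≤ X + hmax * ((k - 1ℤ) * (+ 2 * m) - (+ 2 * P - R) + (O + R)) - H
  H≤X = 0≤-resp eq (∑₂-0≤ λ x y → 0≤-resp (pointwise x y)
          (0≤-* (0≤-+ (μ-bound x y) (0≤-+ (0≤t x y) (0≤r x y))) (h≤hmax x y)))
    where
    lem₀ : ∀ aq p r μ a k t g h → aq ≡ p - r + μ →
      1ℤ * ((aq - (k - 1ℤ) * a) * h) + (g * (k - 1ℤ) * a + (- g * μ + (g * t + (g * r + (- 1ℤ * ((p + t) * h) + 0ℤ)))))
      ≡ ((k - 1ℤ) * a - μ + (t + r)) * (g - h)
    lem₀ _ p r μ a k t g h refl = lem p r μ a k t g h
      where
      lem : ∀ p r μ a k t g h →
        1ℤ * ((p - r + μ - (k - 1ℤ) * a) * h) + (g * (k - 1ℤ) * a + (- g * μ + (g * t + (g * r + (- 1ℤ * ((p + t) * h) + 0ℤ)))))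
        ≡ ((k - 1ℤ) * a - μ + (t + r)) * (g - h)
      lem = solve-∀
    lem₁ : ∀ a q k h → a * (q - (k - 1ℤ)) * h ≡ (a * q - (k - 1ℤ) * a) * h
    lem₁ = solve-∀
    pointwise : ∀ x y →
      1ℤ * (a x y * (q x y - (k - 1ℤ)) * h x y) + (hmax * (k - 1ℤ) * a x y + (- hmax * μ x y + (hmax * t x y + (hmax * r x y + (- 1ℤ * (S₂ x y * h x y) + 0ℤ)))))
      ≡ ((k - 1ℤ) * a x y - μ x y + (t x y + r x y)) * (hmax - h x y)
    pointwise x y = trans
      (cong₂ (λ s c → 1ℤ * s + (hmax * (k - 1ℤ) * a x y + (- hmax * μ x y + (hmax * t x y + (hmax * r x y + (- 1ℤ * (c * h x y) + 0ℤ))))))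
        (lem₁ (a x y) (q x y) k (h x y)) (S₂-eq x y))
      (lem₀ (a x y * q x y) (p x y) (r x y) (μ x y) (a x y) k (t x y) hmax (h x y) (aq-eq x y))
    lem₂ : ∀ X g k m P R O H → X + g * ((k - 1ℤ) * (+ 2 * m) - (+ 2 * P - R) + (O + R)) - H
      ≡ 1ℤ * X + (g * (k - 1ℤ) * (+ 2 * m) + (- g * (+ 2 * P - R) + (g * O + (g * R + (- 1ℤ * H + 0ℤ)))))
    lem₂ = solve-∀
    eq = trans (lem₂ X hmax k m P R O H)
        (trans (cong₂ (λ s μ → 1ℤ * X + (hmax * (k - 1ℤ) * s + (- hmax * μ + (hmax * O + (hmax * R + (- 1ℤ * H + 0ℤ)))))) (sym ∑a) (sym ∑μ))
               (sym (∑₂-combine ((1ℤ , (λ x y → a x y * (q x y - (k - 1ℤ)) * h x y)) ∷ (hmax * (k - 1ℤ) , a) ∷ (- hmax , μ)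
                  ∷ (hmax , t) ∷ (hmax , r) ∷ (- 1ℤ , (λ x y → S₂ x y * h x y)) ∷ []))))

  module _ (0≤k : 0≤ k) (k≤n : 0≤ + n - k) where

    -- The weight 102 n is large enough to absorb the three defects O - 2 m, m (k + 1) - (P + O) and R.
    main-bound : 0≤ + 8 * X + + 102 * (+ n * (+ 3 * (m * (k - 1ℤ)) - AQ)) + + 2 * m * (+ 72 * + n + + 112 * k + + 80)
    main-bound = 0≤-resp
      (trans (cong (λ s → + 8 * X + + 102 * (+ n * (+ 3 * (m * (k - 1ℤ)) - s)) + + 2 * m * (+ 72 * + n + + 112 * k + + 80)) AQ-eq)
             (lem X (+ n) k m P O R H Y))
      -- The factor 32 is 4 times 8, which cancels `Y`. The last three summands are what remains of
      -- the defects in Goodman's term, `102 n` times `3 (m (k + 1) - (P + O)) + 3 (O - 2 m) + 2 R`,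
      -- after the other bounds have used their share.
      (0≤-+ (0≤-+ (0≤-+ (0≤-+ (0≤-+ (0≤-* (0≤ᵐ 8) ∑star) (0≤-* (0≤ᵐ 8) H≤X)) (0≤-* (0≤ᵐ 32) ∑cubes))
         (0≤-* (0≤-+ (0≤-* (0≤ᵐ 64) k≤n) (0≤-* (0≤ᵐ 26) (0≤ᵐ n))) open-pairs))
         (0≤-* (0≤-+ (0≤-* (0≤ᵐ 162) (0≤ᵐ n)) (0≤ᵐ 160)) disjoint-pairs))
         (0≤-* (0≤-+ (0≤-* (0≤ᵐ 60) (0≤ᵐ n)) (0≤-* (0≤ᵐ 64) 0≤k)) 0≤R))
      where
      lem : ∀ X n k m P O R H Y →
        + 8 * X + + 102 * (n * (+ 3 * (m * (k - 1ℤ)) - (+ 3 * P - + 2 * R))) + + 2 * m * (+ 72 * n + + 112 * k + + 80)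
        ≡ + 8 * (H + + 4 * Y + + 20 * (P + O) + + 20 * (k * (O - + 2 * m)))
        + + 8 * (X + (+ 9 * n - + 4 * k) * ((k - 1ℤ) * (+ 2 * m) - (+ 2 * P - R) + (O + R)) - H)
        + + 32 * (+ 2 * k * (m * (k + 1ℤ)) - + 2 * k * (P + O) + + 4 * (k * m) - Y)
        + (+ 64 * (n - k) + + 26 * n) * (O - + 2 * m)
        + (+ 162 * n + + 160) * (m * (k + 1ℤ) - (P + O))
        + (+ 60 * n + + 64 * k) * R
      lem = solve-∀

  -- Degree variance and Goodman's bound

  v U₂ V : ℤ
  v = ∑ u
  U₂ = ∑ (λ x → u x * u x)
  -- `n²` times the variance of `u`.
  V = + n * U₂ - v * v

  ∑-row : ∀ x → ∑ (a x) ≡ + n - u x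
  ∑-row x = sym (trans (cong (λ s → + n - s) (trans (∑-cong λ w → lem₀ (a x w)) (trans (∑-+ (λ _ → 1ℤ) (λ w → - 1ℤ * a x w))
                   (cong₂ _+_ (∑-const n 1ℤ) (∑-*ˡ (- 1ℤ) (a x))))))
                (lem₁ (+ n) (∑ (a x))))
    where
    lem₀ : ∀ p → 1ℤ - p ≡ 1ℤ + - 1ℤ * p
    lem₀ = solve-∀
    lem₁ : ∀ n s → n - (n * 1ℤ + - 1ℤ * s) ≡ s
    lem₁ = solve-∀

  v-eq : v ≡ + n * + n - + 2 * m
  v-eq = trans (lem₁ (+ n) v) (cong (λ s → + n * + n - s) (sym (trans (sym ∑a) (trans (∑-cong λ x → trans (∑-row x) (lem₀ (+ n) (u x)))
               (trans (∑-+ (λ _ → + n) (λ x → - 1ℤ * u x)) (cong₂ _+_ (∑-const n (+ n)) (∑-*ˡ (- 1ℤ) u)))))))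
    where
    lem₀ : ∀ n p → n - p ≡ n + - 1ℤ * p
    lem₀ = solve-∀
    lem₁ : ∀ n v → v ≡ n * n - (n * n + - 1ℤ * v)
    lem₁ = solve-∀

  ∑au : ∑₂ (λ x y → a x y * u x) ≡ + n * v - U₂
  ∑au = trans (∑-cong λ x → trans (∑-*ʳ (u x) (a x)) (trans (cong (_* u x) (∑-row x)) (lem₀ (+ n) (u x))))
       (trans (∑-combine ((+ n , u) ∷ (- 1ℤ , (λ x → u x * u x)) ∷ [])) (lem₁ (+ n) v U₂))
    where
    lem₀ : ∀ n p → (n - p) * p ≡ n * p + (- 1ℤ * (p * p) + 0ℤ)
    lem₀ = solve-∀
    lem₁ : ∀ n v w → n * v + (- 1ℤ * w + 0ℤ) ≡ n * v - w
    lem₁ = solve-∀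

  ∑au′ : ∑₂ (λ x y → a x y * u y) ≡ + n * v - U₂
  ∑au′ = trans (∑-swap (λ x y → a x y * u y)) (trans (∑₂-cong λ y x → cong (_* u y) (a-sym x y)) ∑au)

  -- The deviation of `u x + u y` from twice the mean `v / n`, multiplied by `n` to remain an
  -- integer.
  S : Fin n → Fin n → ℤ
  S x y = + n * (u x + u y) - + 2 * v

  -- The sum is negative for irregular graphs because vertices with many non-neighbours lie on few
  -- edges; this is how the variance becomes a gain.
  ∑aS : ∑₂ (λ x y → a x y * S x y) ≡ - + 2 * V
  ∑aS = trans (∑₂-cong λ x y → lem₀ (a x y) (u x) (u y) (+ n) v)
       (trans (∑₂-combine ((+ n , (λ x y → a x y * u x)) ∷ (+ n , (λ x y → a x y * u y)) ∷ (- + 2 * v , a) ∷ []))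
       (trans (cong₂ (λ s t → + n * s + t) ∑au (cong₂ (λ s t → + n * s + (- + 2 * v * t + 0ℤ)) ∑au′ (trans ∑a (trans (lem₂ (+ n) m) (cong (λ s → + n * + n - s) (sym v-eq))))))
              (lem₁ (+ n) v U₂)))
    where
    lem₀ : ∀ a p q n v → a * (n * (p + q) - + 2 * v) ≡ n * (a * p) + (n * (a * q) + (- + 2 * v * a + 0ℤ))
    lem₀ = solve-∀
    lem₁ : ∀ n v w → n * (n * v - w) + (n * (n * v - w) + (- + 2 * v * (n * n - v) + 0ℤ)) ≡ - + 2 * (n * w - v * v)
    lem₁ = solve-∀
    lem₂ : ∀ n m → + 2 * m ≡ n * n - (n * n - + 2 * m)
    lem₂ = solve-∀

  ∑₂-const : ∀ c → ∑₂ {n} {n} (λ _ _ → c) ≡ + n * (+ n * c)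
  ∑₂-const c = trans (∑-cong {n} λ _ → ∑-const n c) (∑-const n (+ n * c))

  ∑₂-fst : ∀ (f : Fin n → ℤ) → ∑₂ {n} {n} (λ x _ → f x) ≡ + n * ∑ f
  ∑₂-fst f = trans (∑-cong λ x → ∑-const n (f x)) (∑-*ˡ (+ n) f)

  ∑₂-snd : ∀ (f : Fin n → ℤ) → ∑₂ {n} {n} (λ _ y → f y) ≡ + n * ∑ f
  ∑₂-snd f = ∑-const n (∑ f)

  ∑₂-quadratic : ∀ A B C E →
    ∑₂ (λ x y → A * (u x * u x) + (A * (u y * u y) + (B * (u x * u y) + (C * u x + (C * u y + (E * 1ℤ + 0ℤ))))))
    ≡ A * (+ n * U₂) + (A * (+ n * U₂) + (B * (v * v) + (C * (+ n * v) + (C * (+ n * v) + (E * (+ n * (+ n * 1ℤ)) + 0ℤ)))))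
  ∑₂-quadratic A B C E = trans
    (∑₂-combine ((A , (λ x y → u x * u x)) ∷ (A , (λ x y → u y * u y)) ∷ (B , (λ x y → u x * u y)) ∷ (C , (λ x y → u x)) ∷ (C , (λ x y → u y)) ∷ (E , (λ x y → 1ℤ)) ∷ []))
    (cong₂ (λ s t → A * s + t) (∑₂-fst (λ x → u x * u x))
    (cong₂ (λ s t → A * s + t) (∑₂-snd (λ x → u x * u x))
    (cong₂ (λ s t → B * s + t) (sym (∑-** u u))
    (cong₂ (λ s t → C * s + t) (∑₂-fst u)
    (cong₂ (λ s t → C * s + (E * t + 0ℤ)) (∑₂-snd u) (∑₂-const 1ℤ))))))

  0≤V : 0≤ V
  0≤V = 0≤-cancel 1 (0≤-resp
    (trans (lem₁ (+ n) U₂ v) (trans (sym (∑₂-quadratic 1ℤ (- + 2) 0ℤ 0ℤ)) (∑₂-cong λ x y → sym (lem₀ (u x) (u y)))))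
    (∑₂-0≤ λ x y → 0≤-sq (u x - u y)))
    where
    lem₀ : ∀ p q → (p - q) * (p - q) ≡ 1ℤ * (p * p) + (1ℤ * (q * q) + (- + 2 * (p * q) + (0ℤ * p + (0ℤ * q + (0ℤ * 1ℤ + 0ℤ)))))
    lem₀ = solve-∀
    lem₁ : ∀ n w v → + 2 * (n * w - v * v)
      ≡ 1ℤ * (n * w) + (1ℤ * (n * w) + (- + 2 * (v * v) + (0ℤ * (n * v) + (0ℤ * (n * v) + (0ℤ * (n * (n * 1ℤ)) + 0ℤ)))))
    lem₁ = solve-∀

  -- Since S has mean zero, extending the sum from edges to all pairs loses only the factor n²·2V.
  ∑aS² : 0≤ + 2 * (+ n * + n) * V - ∑₂ (λ x y → a x y * (S x y * S x y))
  ∑aS² = 0≤-resp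
    (trans (cong (_- ∑₂ (λ x y → a x y * (S x y * S x y))) all-pairs)
    (trans (lem₃ (∑₂ (λ x y → S x y * S x y)) (∑₂ (λ x y → a x y * (S x y * S x y))))
           (sym (∑₂-combine ((1ℤ , (λ x y → S x y * S x y)) ∷ (- 1ℤ , (λ x y → a x y * (S x y * S x y))) ∷ [])))))
    (∑₂-0≤ λ x y → 0≤-resp (lem₂ (a x y) (S x y)) (0≤-* (0≤b x y) (0≤-sq (S x y))))
    where
    lem₀ : ∀ p q n v → (n * (p + q) - + 2 * v) * (n * (p + q) - + 2 * v)
      ≡ n * n * (p * p) + (n * n * (q * q) + (+ 2 * (n * n) * (p * q) + (- + 4 * (n * v) * p + (- + 4 * (n * v) * q + (+ 4 * (v * v) * 1ℤ + 0ℤ)))))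
    lem₀ = solve-∀
    lem₁ : ∀ n w v → + 2 * (n * n) * (n * w - v * v)
      ≡ n * n * (n * w) + (n * n * (n * w) + (+ 2 * (n * n) * (v * v) + (- + 4 * (n * v) * (n * v) + (- + 4 * (n * v) * (n * v) + (+ 4 * (v * v) * (n * (n * 1ℤ)) + 0ℤ)))))
    lem₁ = solve-∀
    lem₂ : ∀ a s → 1ℤ * (s * s) + (- 1ℤ * (a * (s * s)) + 0ℤ) ≡ (1ℤ - a) * (s * s)
    lem₂ = solve-∀
    lem₃ : ∀ p q → p - q ≡ 1ℤ * p + (- 1ℤ * q + 0ℤ)
    lem₃ = solve-∀
    all-pairs : + 2 * (+ n * + n) * V ≡ ∑₂ (λ x y → S x y * S x y)
    all-pairs = trans (lem₁ (+ n) U₂ v) (trans (sym (∑₂-quadratic (+ n * + n) (+ 2 * (+ n * + n)) (- + 4 * (+ n * v)) (+ 4 * (v * v))))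
      (∑₂-cong λ x y → sym (lem₀ (u x) (u y) (+ n) v)))

  0≤cb : ∀ x y → 0≤ cb x y
  0≤cb x y = ∑-0≤ λ w → 0≤-* (0≤b x w) (0≤b y w)

  cb≤u : ∀ x y → 0≤ u x + u y - + 2 * cb x y
  cb≤u x y = 0≤-resp
    (trans (lem₁ (u x) (u y) (cb x y)) (sym (∑-combine ((1ℤ , b x) ∷ (1ℤ , b y) ∷ (- + 2 , (λ w → b x w * b y w)) ∷ []))))
    (∑-0≤ λ w → 0≤-resp (lem₀ (a x w) (a y w)) (0≤-+ (0≤-* (0≤b x w) (0≤a y w)) (0≤-* (0≤b y w) (0≤a x w))))
    where
    lem₀ : ∀ p q → 1ℤ * (1ℤ - p) + (1ℤ * (1ℤ - q) + (- + 2 * ((1ℤ - p) * (1ℤ - q)) + 0ℤ)) ≡ (1ℤ - p) * q + (1ℤ - q) * p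
    lem₀ = solve-∀
    lem₁ : ∀ p q c → p + q - + 2 * c ≡ 1ℤ * p + (1ℤ * q + (- + 2 * c + 0ℤ))
    lem₁ = solve-∀

  -- The defects give `AQ ≤ 3 m (k - 1)`. By `q-eq`, dropping common non-neighbours,
  -- `AQ ≥ 2 m n - 2 (n v - U₂)`; then `0≤V` replaces `U₂` by `v² / n`, and `v-eq` makes `m` a
  -- common factor.
  goodman : 0≤ m * (+ 3 * (+ n * (k - 1ℤ)) - + 2 * (+ n * + n) + + 4 * v)
  goodman = 0≤-resp identity
      (0≤-+ (0≤-* (0≤ᵐ n) (0≤-+ (0≤-+ (0≤-+ (0≤-* (0≤ᵐ 3) disjoint-pairs) (0≤-* (0≤ᵐ 3) open-pairs)) (0≤-* (0≤ᵐ 2) 0≤R)) codegrees))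
            (0≤-* (0≤ᵐ 2) 0≤V))
    where
    ∑acb : ℤ
    ∑acb = ∑₂ (λ x y → a x y * cb x y)
    codegrees : 0≤ ∑acb
    codegrees = ∑₂-0≤ λ x y → 0≤-* (0≤a x y) (0≤cb x y)
    lem₀ : ∀ a n p q c → a * (n - p - q + c) ≡ n * a + (- 1ℤ * (a * p) + (- 1ℤ * (a * q) + (1ℤ * (a * c) + 0ℤ)))
    lem₀ = solve-∀
    AQ-eq′ : + 3 * P - + 2 * R ≡ + n * (+ 2 * m) + (- 1ℤ * (+ n * v - U₂) + (- 1ℤ * (+ n * v - U₂) + (1ℤ * ∑acb + 0ℤ)))
    AQ-eq′ = trans (sym AQ-eq)
      (trans (∑₂-cong λ x y → trans (cong (a x y *_) (q-eq x y)) (lem₀ (a x y) (+ n) (u x) (u y) (cb x y)))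
      (trans (∑₂-combine ((+ n , a) ∷ (- 1ℤ , (λ x y → a x y * u x)) ∷ (- 1ℤ , (λ x y → a x y * u y)) ∷ (1ℤ , (λ x y → a x y * cb x y)) ∷ []))
             (cong₂ (λ s t → + n * s + t) ∑a (cong₂ (λ s t → - 1ℤ * s + (- 1ℤ * t + (1ℤ * ∑acb + 0ℤ))) ∑au ∑au′))))
    lem₁ : ∀ m n k U P O R v c →
      m * (+ 3 * (n * (k - 1ℤ)) - + 2 * (n * n) + + 4 * v)
      ≡ n * (+ 3 * (m * (k + 1ℤ) - (P + O)) + + 3 * (O - + 2 * m) + + 2 * R + c)
        + n * ((+ 3 * P - + 2 * R) - (n * (+ 2 * m) + (- 1ℤ * (n * v - U) + (- 1ℤ * (n * v - U) + (1ℤ * c + 0ℤ)))))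
        + + 2 * (n * U - n * n * v + + 2 * (m * v))
    lem₁ = solve-∀
    lem₂ : ∀ n w A U v m → v ≡ n * n - + 2 * m →
      w + n * (A - A) + + 2 * (n * U - n * n * v + + 2 * (m * v)) ≡ w + + 2 * (n * U - v * v)
    lem₂ n w A U _ m refl = lem n w A U m
      where
      lem : ∀ n w A U m → w + n * (A - A) + + 2 * (n * U - n * n * (n * n - + 2 * m) + + 2 * (m * (n * n - + 2 * m)))
        ≡ w + + 2 * (n * U - (n * n - + 2 * m) * (n * n - + 2 * m))
      lem = solve-∀
    Z : ℤ
    Z = + n * (+ 3 * (m * (k + 1ℤ) - (P + O)) + + 3 * (O - + 2 * m) + + 2 * R + ∑acb)
    A : ℤ
    A = + n * (+ 2 * m) + (- 1ℤ * (+ n * v - U₂) + (- 1ℤ * (+ n * v - U₂) + (1ℤ * ∑acb + 0ℤ)))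
    identity : m * (+ 3 * (+ n * (k - 1ℤ)) - + 2 * (+ n * + n) + + 4 * v) ≡ Z + + 2 * V
    identity = trans (lem₁ m (+ n) k U₂ P O R v ∑acb)
      (trans (cong (λ s → Z + + n * (s - A) + + 2 * (+ n * U₂ - + n * + n * v + + 2 * (m * v))) AQ-eq′)
             (lem₂ (+ n) Z A U₂ v m v-eq))

  -- E is, up to a positive factor, the gap between the upper bound and Goodman's lower bound for AQ.
  E Φ : ℤ
  E = + 3 * (+ n * (k - 1ℤ)) + + 2 * (+ n * + n) - + 8 * m
  Φ = + n * + n * (+ 72 * + n + + 112 * k + + 80 - + 4 * ((k - 1ℤ) * (+ 6 * + n - + 11 * k + + 15)))
    + E * (+ n * (+ 75 * + n - + 64 * k + + 80)) + + 20 * (E * E)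

  -- Handed to `Contradiction`, where `E` is a variable known only through this equation.
  E-eq : E ≡ + 3 * (+ n * (k - 1ℤ)) + + 2 * (+ n * + n) - + 8 * m
  E-eq = refl

  Φ-eq : Φ ≡ + n * + n * (+ 72 * + n + + 112 * k + + 80 - + 4 * ((k - 1ℤ) * (+ 6 * + n - + 11 * k + + 15)))
    + E * (+ n * (+ 75 * + n - + 64 * k + + 80)) + + 20 * (E * E)
  Φ-eq = refl

  0≤mE : 0≤ m * E
  0≤mE = 0≤-resp (trans (lem (+ n) k m) (cong (λ s → m * (+ 3 * (+ n * (k - 1ℤ)) - + 2 * (+ n * + n) + + 4 * s)) (sym v-eq))) goodman
    where
    lem : ∀ n k m → m * (+ 3 * (n * (k - 1ℤ)) + + 2 * (n * n) - + 8 * m) ≡ m * (+ 3 * (n * (k - 1ℤ)) - + 2 * (n * n) + + 4 * (n * n - + 2 * m))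
    lem = solve-∀

  -- Deviations of degrees and common non-neighbours as a quadratic form

  module _ (0≤k : 0≤ k) (k≤n : 0≤ + n - k)
           (linear : 0≤ + 80 * E + + n * (+ 43 * + n - + 128 * k + + 160))
           (mixed : 0≤ + 58 * E + + n * (+ 58 * k - + 14 * + n - + 26)) where
    private
      w B : ℤ
      w = + 320 * v - + 10 * (+ n * + n) + + 112 * (+ n * k) - + 80 * + n
      B = + 560 * v - + 130 * (+ n * + n) + + 232 * (+ n * k) - + 200 * + n

      -- The critical case is `n = 3 k`: to leading order `E = 0` means `v = n² / 4`, and `w` is
      -- then `(107 + 1/3) n²`.
      w-bound : 0≤ w - + 107 * (+ n * + n)
      w-bound = 0≤-resp (trans (cong (λ s → + 320 * s - + 10 * (+ n * + n) + + 112 * (+ n * k) - + 80 * + n - + 107 * (+ n * + n)) v-eq) (lem (+ n) k m)) linear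
        where
        lem : ∀ n k m → + 320 * (n * n - + 2 * m) - + 10 * (n * n) + + 112 * (n * k) - + 80 * n - + 107 * (n * n)
          ≡ + 80 * (+ 3 * (n * (k - 1ℤ)) + + 2 * (n * n) - + 8 * m) + n * (+ 43 * n - + 128 * k + + 160)
        lem = solve-∀

      -- Here `n = 4 k` is critical: to leading order `E = 0` means `v = 5 n² / 16`, where `B` is
      -- `103 n²` and `328 v` is `102.5 n²`.
      B-bound : 0≤ B - + 328 * v
      B-bound = 0≤-resp (trans (cong (λ s → + 560 * s - + 130 * (+ n * + n) + + 232 * (+ n * k) - + 200 * + n - + 328 * s) v-eq) (lem (+ n) k m)) mixed
        where
        lem : ∀ n k m → + 560 * (n * n - + 2 * m) - + 130 * (n * n) + + 232 * (n * k) - + 200 * n - + 328 * (n * n - + 2 * m)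
          ≡ + 58 * (+ 3 * (n * (k - 1ℤ)) + + 2 * (n * n) - + 8 * m) + n * (+ 58 * k - + 14 * n - + 26)
        lem = solve-∀

      form : ℤ → ℤ → ℤ
      form s y = B * y - + 200 * (y * y) + + 280 * (s * y) + + 27 * (s * s)

      -- B y ≥ 328 v y ≥ 164 y (2 y - s) leaves the positive definite form 128 y² + 116 s y + 27 s².
      0≤form : ∀ s y → 0≤ y → 0≤ s + + 2 * v - + 2 * y → 0≤ form s y
      0≤form s y 0≤y y≤ = 0≤-resp (lem B v s y)
        (0≤-+ (0≤-+ (0≤-+ (0≤-+ (0≤-+ (0≤-* B-bound 0≤y) (0≤-* (0≤-* (0≤ᵐ 164) 0≤y) y≤)) (0≤-sq (+ 11 * y + + 5 * s)))
          (0≤-sq (+ 2 * y + s))) (0≤-sq (y + s))) (0≤-* (0≤ᵐ 2) (0≤-sq y)))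
        where
        lem : ∀ B v s y → B * y - + 200 * (y * y) + + 280 * (s * y) + + 27 * (s * s)
          ≡ (B - + 328 * v) * y + + 164 * y * (s + + 2 * v - + 2 * y) + (+ 11 * y + + 5 * s) * (+ 11 * y + + 5 * s)
            + (+ 2 * y + s) * (+ 2 * y + s) + (y + s) * (y + s) + + 2 * (y * y)
        lem = solve-∀

      y : Fin n → Fin n → ℤ
      y x x′ = + n * cb x x′

      -- The constant term of the expansion below: degrees at their mean and no common
      -- non-neighbours.
      Φ′ : ℤ
      Φ′ = - + 8 * ((+ n * (+ n - k + 1ℤ) - + 2 * v) * (+ 20 * v - + 4 * (+ n * (+ n - k))))
         + + 51 * (+ n * + n * (+ 3 * (+ n * (k - 1ℤ)) - + 2 * (+ n * + n) + + 4 * v))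
         + + 8 * (+ n * (+ 9 * (+ n * + n) + + 14 * (+ n * k) + + 10 * + n))

      -- The true coefficient of `s²` is 80, split as `107 - 27`. The 27 is lent to `form`, where it
      -- is the least integer making `128 y² + 116 s y + 27 s²` positive definite; the 107 is paid
      -- for by the variance.
      pointwise : ∀ a n k v p q c →
        let s = n * (p + q) - + 2 * v
            y = n * c
            w = + 320 * v - + 10 * (n * n) + + 112 * (n * k) - + 80 * n
            B = + 560 * v - + 130 * (n * n) + + 232 * (n * k) - + 200 * n
        in + 8 * (n * n) * (a * (n - p - q + c - (k - 1ℤ)) * (+ 25 * c - + 10 * (p + q) + + 4 * (n - k)))
           + (- + 102 * (n * n * n) * (a * (n - p - q + c))
           -- Terms of `main-bound` proportional to `m` are spread over the `2 m` ordered edges,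
           -- hence 153, half of 3 times 102.
           + (n * n * (+ 153 * (n * (k - 1ℤ)) + + 72 * n + + 112 * k + + 80) * a + 0ℤ))
           ≡ (- + 8 * ((n * (n - k + 1ℤ) - + 2 * v) * (+ 20 * v - + 4 * (n * (n - k))))
              + + 51 * (n * n * (+ 3 * (n * (k - 1ℤ)) - + 2 * (n * n) + + 4 * v))
              + + 8 * (n * (+ 9 * (n * n) + + 14 * (n * k) + + 10 * n))) * a
             + (w * (a * s) + (+ 107 * (a * (s * s)) + (- 1ℤ * (a * (B * y - + 200 * (y * y) + + 280 * (s * y) + + 27 * (s * s))) + 0ℤ)))
      pointwise = solve-∀

      ∑form : ℤ
      ∑form = ∑₂ (λ x x′ → a x x′ * form (S x x′) (y x x′))

      0≤∑form : 0≤ ∑form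
      0≤∑form = ∑₂-0≤ λ x x′ → 0≤-* (0≤a x x′) (0≤form (S x x′) (y x x′) (0≤-* (0≤ᵐ n) (0≤cb x x′))
        (0≤-resp (lem (+ n) v (u x) (u x′) (cb x x′)) (0≤-* (0≤ᵐ n) (cb≤u x x′))))
        where
        lem : ∀ n v p q c → n * (p + q) - + 2 * v + + 2 * v - + 2 * (n * c) ≡ n * (p + q - + 2 * c)
        lem = solve-∀

      summed : + 8 * (+ n * + n) * X + (- + 102 * (+ n * + n * + n) * AQ
             + (+ n * + n * (+ 153 * (+ n * (k - 1ℤ)) + + 72 * + n + + 112 * k + + 80) * (+ 2 * m) + 0ℤ))
        ≡ Φ′ * (+ 2 * m) + (w * (- + 2 * V) + (+ 107 * ∑₂ (λ x x′ → a x x′ * (S x x′ * S x x′)) + (- 1ℤ * ∑form + 0ℤ)))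
      summed =
        trans (cong (λ s → + 8 * (+ n * + n) * X + (- + 102 * (+ n * + n * + n) * AQ
             + (+ n * + n * (+ 153 * (+ n * (k - 1ℤ)) + + 72 * + n + + 112 * k + + 80) * s + 0ℤ))) (sym ∑a))
       (trans (sym (∑₂-combine ((+ 8 * (+ n * + n) , (λ x x′ → a x x′ * (q x x′ - (k - 1ℤ)) * h x x′))
             ∷ (- + 102 * (+ n * + n * + n) , (λ x x′ → a x x′ * q x x′))
             ∷ (+ n * + n * (+ 153 * (+ n * (k - 1ℤ)) + + 72 * + n + + 112 * k + + 80) , a) ∷ [])))
       (trans (∑₂-cong λ x x′ → trans
                (cong (λ s → + 8 * (+ n * + n) * (a x x′ * (s - (k - 1ℤ)) * h x x′) + (- + 102 * (+ n * + n * + n) * (a x x′ * s)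
                   + (+ n * + n * (+ 153 * (+ n * (k - 1ℤ)) + + 72 * + n + + 112 * k + + 80) * a x x′ + 0ℤ))) (q-eq x x′))
                (pointwise (a x x′) (+ n) k v (u x) (u x′) (cb x x′)))
       (trans (∑₂-combine ((Φ′ , a) ∷ (w , (λ x x′ → a x x′ * S x x′)) ∷ (+ 107 , (λ x x′ → a x x′ * (S x x′ * S x x′)))
             ∷ (- 1ℤ , (λ x x′ → a x x′ * form (S x x′) (y x x′))) ∷ []))
              (cong₂ (λ s t → Φ′ * s + (w * t + (+ 107 * ∑₂ (λ x x′ → a x x′ * (S x x′ * S x x′)) + (- 1ℤ * ∑form + 0ℤ)))) ∑a ∑aS))))

      Φ≡Φ′ : Φ ≡ Φ′
      Φ≡Φ′ = trans (lem (+ n) k m)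
        (cong (λ v → - + 8 * ((+ n * (+ n - k + 1ℤ) - + 2 * v) * (+ 20 * v - + 4 * (+ n * (+ n - k))))
         + + 51 * (+ n * + n * (+ 3 * (+ n * (k - 1ℤ)) - + 2 * (+ n * + n) + + 4 * v))
         + + 8 * (+ n * (+ 9 * (+ n * + n) + + 14 * (+ n * k) + + 10 * + n))) (sym v-eq))
        where
        lem : ∀ n k m →
          let E = + 3 * (n * (k - 1ℤ)) + + 2 * (n * n) - + 8 * m
              v = n * n - + 2 * m
          in n * n * (+ 72 * n + + 112 * k + + 80 - + 4 * ((k - 1ℤ) * (+ 6 * n - + 11 * k + + 15)))
             + E * (n * (+ 75 * n - + 64 * k + + 80)) + + 20 * (E * E)
             ≡ - + 8 * ((n * (n - k + 1ℤ) - + 2 * v) * (+ 20 * v - + 4 * (n * (n - k))))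
              + + 51 * (n * n * (+ 3 * (n * (k - 1ℤ)) - + 2 * (n * n) + + 4 * v))
              + + 8 * (n * (+ 9 * (n * n) + + 14 * (n * k) + + 10 * n))
        lem = solve-∀

    -- Summed over edges, the linear term of `pointwise` gives `- 2 w V` and the square at most
    -- `107 * 2 n² V`, so `w-bound` makes them nonpositive together. The form is subtracted, and
    -- only `Φ` can carry the nonnegative total of `main-bound`.
    0≤mΦ : 0≤ m * Φ
    0≤mΦ = 0≤-cancel 1 (0≤-resp identity
      (0≤-+ (0≤-+ (0≤-+ (0≤-* (0≤-* (0≤ᵐ n) (0≤ᵐ n)) (main-bound 0≤k k≤n)) 0≤∑form)
                  (0≤-* (0≤-* (0≤ᵐ 2) 0≤V) w-bound))
            (0≤-* (0≤ᵐ 107) ∑aS²)))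
      where
      aS² : ℤ
      aS² = ∑₂ (λ x x′ → a x x′ * (S x x′ * S x x′))
      lem : ∀ X A n k m Φ w V Z F →
        + 8 * (n * n) * X + (- + 102 * (n * n * n) * A + (n * n * (+ 153 * (n * (k - 1ℤ)) + + 72 * n + + 112 * k + + 80) * (+ 2 * m) + 0ℤ))
          ≡ Φ * (+ 2 * m) + (w * (- + 2 * V) + (+ 107 * Z + (- 1ℤ * F + 0ℤ))) →
        + 2 * (m * Φ)
        ≡ n * n * (+ 8 * X + + 102 * (n * (+ 3 * (m * (k - 1ℤ)) - A)) + + 2 * m * (+ 72 * n + + 112 * k + + 80)) + F
          + + 2 * V * (w - + 107 * (n * n)) + + 107 * (+ 2 * (n * n) * V - Z)
      lem X A n k m Φ w V Z F eq =
        trans (lem₁ Φ m w V Z F)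
       (trans (cong (λ s → s + + 2 * V * w - + 107 * Z + F) (sym eq)) (lem₂ X A n k m w V Z F))
        where
        lem₁ : ∀ Φ m w V Z F → + 2 * (m * Φ) ≡ (Φ * (+ 2 * m) + (w * (- + 2 * V) + (+ 107 * Z + (- 1ℤ * F + 0ℤ)))) + + 2 * V * w - + 107 * Z + F
        lem₁ = solve-∀
        lem₂ : ∀ X A n k m w V Z F →
          + 8 * (n * n) * X + (- + 102 * (n * n * n) * A + (n * n * (+ 153 * (n * (k - 1ℤ)) + + 72 * n + + 112 * k + + 80) * (+ 2 * m) + 0ℤ)) + + 2 * V * w - + 107 * Z + F
          ≡ n * n * (+ 8 * X + + 102 * (n * (+ 3 * (m * (k - 1ℤ)) - A)) + + 2 * m * (+ 72 * n + + 112 * k + + 80)) + F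
            + + 2 * V * (w - + 107 * (n * n)) + + 107 * (+ 2 * (n * n) * V - Z)
        lem₂ = solve-∀
      identity = trans (cong (λ s → + 2 * (m * s)) Φ≡Φ′) (lem X AQ (+ n) k m Φ′ w V aS² ∑form summed)

-- The numerical contradiction

0≤-split : ∀ x → 0≤ x ⊎ 0≤ -1ℤ - x
0≤-split (+ m) = inj₁ (0≤ᵐ m)
0≤-split -[1+ m ] = inj₂ (0≤ᵐ m)

-- Certificates of infeasibility take this shape: a nonnegative combination of the hypotheses that
-- is identically -1.
¬0≤-1 : ∀ {x} → x ≡ -1ℤ → 0≤ x → ⊥
¬0≤-1 refl ()

-- n² c + n s E + 20 E² is increasing in E, so it may be evaluated at the upper bound n φ / r of E.
quadratic-contradiction : ∀ n r c s φ E → 0≤ n - 1ℤ → 0≤ r → 0≤ E → 0≤ s → 0≤ n * φ - r * E →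
  0≤ - (r * r * c + r * (s * φ) + + 20 * (φ * φ)) - 1ℤ →
  0≤ n * n * c + E * (n * s) + + 20 * (E * E) → ⊥
quadratic-contradiction n r c s φ E 1≤n 0≤r 0≤E 0≤s E≤φ 0<gap 0≤Φ = ¬0≤-1 (lem n r c s φ E)
  (0≤-+ (0≤-+ (0≤-+ (0≤-+ (0≤-+ (0≤-* (0≤-sq r) 0≤Φ)
    (0≤-* (0≤-* 0≤r (0≤-* 0≤n 0≤s)) E≤φ))
    (0≤-* (0≤-* (0≤ᵐ 20) E≤φ) (0≤-+ E≤φ (0≤-* (0≤-* (0≤ᵐ 2) 0≤r) 0≤E))))
    -- The strict gap leaves `- n²`, and `(n - 1)² + 2 (n - 1) = n² - 1` turns it into -1.
    (0≤-* (0≤-sq n) 0<gap)) (0≤-sq (n - 1ℤ))) (0≤-* (0≤ᵐ 2) 1≤n))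
  where
  0≤n : 0≤ n
  0≤n = 0≤-resp (lem₀ n) (0≤-+ 1≤n (0≤ᵐ 1))
    where
    lem₀ : ∀ n → n ≡ n - 1ℤ + 1ℤ
    lem₀ = solve-∀
  lem : ∀ n r c s φ E →
    r * r * (n * n * c + E * (n * s) + + 20 * (E * E))
    + r * (n * s) * (n * φ - r * E)
    + + 20 * (n * φ - r * E) * (n * φ - r * E + + 2 * r * E)
    + n * n * (- (r * r * c + r * (s * φ) + + 20 * (φ * φ)) - 1ℤ) + (n - 1ℤ) * (n - 1ℤ) + + 2 * (n - 1ℤ)
    ≡ -1ℤ
  lem = solve-∀

-- r E ≤ n φ, and φ ≥ 0 forces k ≥ κ; the polynomial to be bounded is expanded around k = κ, n = b k.
module Numeric (b κ p r : ℤ) where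

  φ₁ φ₀ A₀ A₁ B₀ B₁ s₀ s₁ : ℤ
  φ₁ = + 3 * r + + 2 * (b * r) - + 8 * p
  φ₀ = φ₁ * κ - + 3 * r
  A₁ = + 6 * b - + 11
  A₀ = A₁ * κ + + 15
  B₁ = + 9 * b + + 14
  B₀ = B₁ * κ + + 10
  s₁ = + 75 * b - + 64
  s₀ = s₁ * κ + + 80

  -- With `K = k - κ` and `j = b k - n`, the coefficients of `1`, `K`, `K²`, `j` and `K j`; `C₀`
  -- includes the -1 for strictness.
  C₀ C₁ C₂ C₃ C₄ : ℤ
  C₀ = + 4 * (r * r) * ((κ - 1ℤ) * A₀) - + 8 * (r * r) * B₀ - r * (s₀ * φ₀) - + 20 * (φ₀ * φ₀) - 1ℤ
  C₁ = + 4 * (r * r) * ((κ - 1ℤ) * A₁ + A₀) - + 8 * (r * r) * B₁ - r * (s₀ * φ₁ + s₁ * φ₀) - + 40 * (φ₀ * φ₁)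
  C₂ = + 4 * (r * r) * A₁ - r * (s₁ * φ₁) - + 20 * (φ₁ * φ₁)
  C₃ = + 72 * (r * r) - + 24 * (r * r) * (κ - 1ℤ) + r * (+ 2 * r * s₀ + + 75 * φ₀) + + 80 * (r * φ₀) - + 230 * (r * r) * (b - 1ℤ)
  C₄ = r * (+ 2 * r * s₁ + + 75 * φ₁) + + 80 * (r * φ₁) - + 24 * (r * r)

  φ : ℤ → ℤ → ℤ
  φ n k = r * (+ 3 * (k - 1ℤ) + + 2 * n) - + 8 * (p * k)

  module _ (0≤C₀ : 0≤ C₀) (0≤C₁ : 0≤ C₁) (0≤C₂ : 0≤ C₂) (0≤C₃ : 0≤ C₃) (0≤C₄ : 0≤ C₄) where

    -- The one negative term, `- 230 r² j²`, equals `- 230 r² (b - 1) j + 230 r² j (b - 1 -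
    -- j)`. The first part is charged to `C₃`; the second is nonnegative because rounding `n / b` up
    -- leaves `0 ≤ j ≤ b - 1`.
    gap-positive : ∀ n k → 0≤ k - κ → 0≤ b * k - n → 0≤ n - (b * k - (b - 1ℤ)) →
      0≤ - (r * r * (+ 72 * n + + 112 * k + + 80 - + 4 * ((k - 1ℤ) * (+ 6 * n - + 11 * k + + 15)))
            + r * ((+ 75 * n - + 64 * k + + 80) * φ n k) + + 20 * (φ n k * φ n k)) - 1ℤ
    gap-positive n k 0≤K 0≤j 0≤J = 0≤-resp
      (trans (cong₂ _-_ (cong -_ (cong₂ _+_ (cong₂ _+_
        (cong (r * r *_) (cong₂ (λ x y → x - + 4 * y) (eB n k b κ) (cong₂ _*_ (e1 k κ) (eA n k b κ))))
        (cong (r *_) (cong₂ _*_ (eS n k b κ) (eφ n k b κ p r))))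
        (cong (+ 20 *_) (cong₂ _*_ (eφ n k b κ p r) (eφ n k b κ p r))))) refl)
      (trans (expand r (κ - 1ℤ) A₀ A₁ B₀ B₁ s₀ s₁ φ₀ φ₁ (k - κ) (b * k - n) (b - 1ℤ))
             (cong (λ J → C₀ + C₁ * (k - κ) + C₂ * ((k - κ) * (k - κ)) + C₃ * (b * k - n) + C₄ * ((k - κ) * (b * k - n)) + + 230 * (r * r) * ((b * k - n) * J))
                   (eJ n k b))))
      (0≤-+ (0≤-+ (0≤-+ (0≤-+ (0≤-+ 0≤C₀ (0≤-* 0≤C₁ 0≤K)) (0≤-* 0≤C₂ (0≤-sq (k - κ)))) (0≤-* 0≤C₃ 0≤j)) (0≤-* 0≤C₄ (0≤-* 0≤K 0≤j)))
            (0≤-* (0≤-* (0≤ᵐ 230) (0≤-sq r)) (0≤-* 0≤j 0≤J)))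
      where
      e1 : ∀ k κ → k - 1ℤ ≡ κ - 1ℤ + (k - κ)
      e1 = solve-∀
      eJ : ∀ n k b → b - 1ℤ - (b * k - n) ≡ n - (b * k - (b - 1ℤ))
      eJ = solve-∀
      eA : ∀ n k b κ → + 6 * n - + 11 * k + + 15 ≡ (+ 6 * b - + 11) * κ + + 15 + (+ 6 * b - + 11) * (k - κ) - + 6 * (b * k - n)
      eA = solve-∀
      eB : ∀ n k b κ → + 72 * n + + 112 * k + + 80 ≡ + 8 * ((+ 9 * b + + 14) * κ + + 10 + (+ 9 * b + + 14) * (k - κ) - + 9 * (b * k - n))
      eB = solve-∀
      eS : ∀ n k b κ → + 75 * n - + 64 * k + + 80 ≡ (+ 75 * b - + 64) * κ + + 80 + (+ 75 * b - + 64) * (k - κ) - + 75 * (b * k - n)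
      eS = solve-∀
      eφ : ∀ n k b κ p r → r * (+ 3 * (k - 1ℤ) + + 2 * n) - + 8 * (p * k)
        ≡ (+ 3 * r + + 2 * (b * r) - + 8 * p) * κ - + 3 * r + (+ 3 * r + + 2 * (b * r) - + 8 * p) * (k - κ) - + 2 * r * (b * k - n)
      eφ = solve-∀
      expand : ∀ r κ₁ A₀ A₁ B₀ B₁ s₀ s₁ φ₀ φ₁ K j b₁ →
        - (r * r * (+ 8 * (B₀ + B₁ * K - + 9 * j) - + 4 * ((κ₁ + K) * (A₀ + A₁ * K - + 6 * j)))
           + r * ((s₀ + s₁ * K - + 75 * j) * (φ₀ + φ₁ * K - + 2 * r * j))
           + + 20 * ((φ₀ + φ₁ * K - + 2 * r * j) * (φ₀ + φ₁ * K - + 2 * r * j))) - 1ℤ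
        ≡ (+ 4 * (r * r) * (κ₁ * A₀) - + 8 * (r * r) * B₀ - r * (s₀ * φ₀) - + 20 * (φ₀ * φ₀) - 1ℤ)
          + (+ 4 * (r * r) * (κ₁ * A₁ + A₀) - + 8 * (r * r) * B₁ - r * (s₀ * φ₁ + s₁ * φ₀) - + 40 * (φ₀ * φ₁)) * K
          + (+ 4 * (r * r) * A₁ - r * (s₁ * φ₁) - + 20 * (φ₁ * φ₁)) * (K * K)
          + (+ 72 * (r * r) - + 24 * (r * r) * κ₁ + r * (+ 2 * r * s₀ + + 75 * φ₀) + + 80 * (r * φ₀) - + 230 * (r * r) * b₁) * j
          + (r * (+ 2 * r * s₁ + + 75 * φ₁) + + 80 * (r * φ₁) - + 24 * (r * r)) * (K * j)
          + + 230 * (r * r) * (j * (b₁ - j))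
      expand = solve-∀

-- From coloured graphs to rainbow-free colourings

lookup-injective : ∀ {A : Set} {xs : List A} → Unique xs → ∀ i j → lookup xs i ≡ lookup xs j → i ≡ j
lookup-injective (_ ∷ _) zero zero _ = refl
lookup-injective (x∉ ∷ _) zero (suc j) eq = ⊥-elim (All.lookup x∉ (∈-lookup j) eq)
lookup-injective (x∉ ∷ _) (suc i) zero eq = ⊥-elim (All.lookup x∉ (∈-lookup i) (sym eq))
lookup-injective (_ ∷ u) (suc i) (suc j) eq = cong suc (lookup-injective u i j eq)

occurrences : ∀ {n} → List (Fin n × Fin n) → Fin n → Fin n → ℤ
occurrences [] x y = 0ℤ
occurrences ((u , v) ∷ l) x y = δ x u * δ y v + occurrences l x y

∑₂-occurrences : ∀ {n} (l : List (Fin n × Fin n)) → ∑₂ (occurrences l) ≡ + length l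
∑₂-occurrences {n} [] = trans (∑-cong {n} λ _ → ∑-zero {n}) (∑-zero {n})
∑₂-occurrences {n} ((u , v) ∷ l) =
  trans (∑₂-cong λ x y → lem (δ x u * δ y v) (occurrences l x y))
 (trans (∑₂-combine ((1ℤ , (λ x y → δ x u * δ y v)) ∷ (1ℤ , occurrences l) ∷ []))
 (trans (cong₂ (λ s t → 1ℤ * s + (1ℤ * t + 0ℤ))
          (trans (∑-cong λ x → ∑-*ˡ (δ x u) (λ y → δ y v)) (trans (∑-δ (λ _ → ∑ (λ y → δ y v)) u)
                 (trans (∑-cong λ y → sym (*-identityʳ (δ y v))) (∑-δ (λ _ → 1ℤ) v))))
          (∑₂-occurrences l))
        (lem′ (+ length l))))
  where
  lem : ∀ p q → p + q ≡ 1ℤ * p + (1ℤ * q + 0ℤ)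
  lem = solve-∀
  lem′ : ∀ p → 1ℤ * 1ℤ + (1ℤ * p + 0ℤ) ≡ 1ℤ + p
  lem′ = solve-∀

occurrences-∉ : ∀ {n} {l : List (Fin n × Fin n)} {x y} → (x , y) ∉ l → occurrences l x y ≡ 0ℤ
occurrences-∉ {l = []} _ = refl
occurrences-∉ {l = (u , v) ∷ l} {x} {y} ∉l =
  trans (cong₂ _+_ head≡0 (occurrences-∉ {l = l} λ ∈l → ∉l (there ∈l))) (+-identityˡ 0ℤ)
  where
  head≡0 : δ x u * δ y v ≡ 0ℤ
  head≡0 with x Fin.≟ u | y Fin.≟ v
  ... | yes refl | yes refl = ⊥-elim (∉l (here refl))
  ... | yes _ | no _ = refl
  ... | no _ | yes _ = refl
  ... | no _ | no _ = refl

occurrences-∈ : ∀ {n} {l : List (Fin n × Fin n)} {x y} → Unique l → (x , y) ∈ l → occurrences l x y ≡ 1ℤ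
occurrences-∈ {l = (u , v) ∷ l} (u∉ ∷ _) (here refl) =
  cong₂ _+_ (cong₂ _*_ (δ-refl u) (δ-refl v)) (occurrences-∉ λ ∈l → All.lookup u∉ ∈l refl)
occurrences-∈ {l = (u , v) ∷ l} {x} {y} (u∉ ∷ uniq) (there ∈l) =
  trans (cong₂ _+_ head≡0 (occurrences-∈ uniq ∈l)) (+-identityˡ 1ℤ)
  where
  head≡0 : δ x u * δ y v ≡ 0ℤ
  head≡0 with x Fin.≟ u | y Fin.≟ v
  ... | yes refl | yes refl = ⊥-elim (All.lookup u∉ ∈l refl)
  ... | yes _ | no _ = refl
  ... | no _ | yes _ = refl
  ... | no _ | no _ = refl

-- The counting only refutes the absence of a rainbow triangle; a finite search makes this
-- refutation a triangle.
hasRainbowTriangle? : ∀ {n} (G : SimpleGraph n) (f : EdgeColoring G) → Dec (HasRainbowTriangle G f)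
hasRainbowTriangle? G f = Fin.any? λ i → Fin.any? λ j → Fin.any? λ k →
  T? (adj G i j) ×-dec T? (adj G j k) ×-dec T? (adj G i k)
  ×-dec ¬? (col f i j ℕ.≟ col f j k) ×-dec ¬? (col f j k ℕ.≟ col f i k) ×-dec ¬? (col f i j ℕ.≟ col f i k)

module FromGraph {n : ℕ} (G : SimpleGraph n) (f : EdgeColoring G) (cs : List ℕ) (cs! : Unique cs)
  (k : ℕ) (large : All (λ c → k ℕ.≤ classSize G f c) cs) (¬rainbow : ¬ HasRainbowTriangle G f) where

  N : ℕ
  N = length cs

  class : Fin N → List (Fin n × Fin n)
  class i = take k (colorClass G f (lookup cs i))

  class-length : ∀ i → length (class i) ≡ k
  class-length i = trans (length-take k (colorClass G f (lookup cs i))) (ℕ.m≤n⇒m⊓n≡m (All.lookup large (∈-lookup i)))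

  class! : ∀ i → Unique (class i)
  class! i = Unique.take⁺ k (Unique.filter⁺ _ (Unique.cartesianProduct⁺ (Unique.allFin⁺ n) (Unique.allFin⁺ n)))

  class-edge : ∀ i {x y} → (x , y) ∈ class i → toℕ x ℕ.< toℕ y × adj G x y ≡ true × col f x y ≡ lookup cs i
  class-edge i = All.lookup (All.take⁺ k (All.all-filter _ (cartesianProduct (allFin n) (allFin n))))

  _∈?_ : ∀ (p : Fin n × Fin n) l → Dec (p ∈ l)
  _∈?_ = Membership._∈?_ (≡-dec Fin._≟_ Fin._≟_)

  e : Fin N → Fin n → Fin n → ℤ
  e i x y = occurrences (class i) x y + occurrences (class i) y x

  -- All classes list an edge with its smaller end first, so the two orientations added in `e` never
  -- overlap, even between different colours.
  reversed : ∀ {i j x y} → (x , y) ∈ class i → (y , x) ∉ class j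
  reversed {i} {j} ∈i ∈j = ℕ.<-asym (proj₁ (class-edge i ∈i)) (proj₁ (class-edge j ∈j))

  e-∉ : ∀ {i x y} → (x , y) ∉ class i → (y , x) ∉ class i → e i x y ≡ 0ℤ
  e-∉ xy∉ yx∉ = cong₂ _+_ (occurrences-∉ xy∉) (occurrences-∉ yx∉)

  e-∈ˡ : ∀ {i x y} → (x , y) ∈ class i → e i x y ≡ 1ℤ
  e-∈ˡ {i} xy∈ = cong₂ _+_ (occurrences-∈ (class! i) xy∈) (occurrences-∉ (reversed {i} {i} xy∈))

  e-∈ʳ : ∀ {i x y} → (y , x) ∈ class i → e i x y ≡ 1ℤ
  e-∈ʳ {i} yx∈ = cong₂ _+_ (occurrences-∉ (reversed {i} {i} yx∈)) (occurrences-∈ (class! i) yx∈)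

  same-class : ∀ {i j x y} → (x , y) ∈ class i → (x , y) ∈ class j → i ≡ j
  same-class {i} {j} ∈i ∈j =
    lookup-injective cs! i j (trans (sym (proj₂ (proj₂ (class-edge i ∈i)))) (proj₂ (proj₂ (class-edge j ∈j))))

  palette : ∀ x y → (∀ i → e i x y ≡ 0ℤ) ⊎ (∃[ c ] ∀ i → e i x y ≡ δ i c)
  palette x y with Fin.any? (λ i → ((x , y) ∈? class i) ⊎-dec ((y , x) ∈? class i))
  ... | no none = inj₁ λ i → e-∉ (λ xy∈ → none (i , inj₁ xy∈)) (λ yx∈ → none (i , inj₂ yx∈))
  ... | yes (c , inj₁ xy∈) = inj₂ (c , only)
    where
    only : ∀ i → e i x y ≡ δ i c
    only i with i Fin.≟ c
    ... | yes refl = e-∈ˡ {i} xy∈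
    ... | no i≢c = e-∉ (λ ∈i → i≢c (same-class ∈i xy∈)) (reversed {c} {i} xy∈)
  ... | yes (c , inj₂ yx∈) = inj₂ (c , only)
    where
    only : ∀ i → e i x y ≡ δ i c
    only i with i Fin.≟ c
    ... | yes refl = e-∈ʳ {i} yx∈
    ... | no i≢c = e-∉ (reversed {c} {i} yx∈) (λ ∈i → i≢c (same-class ∈i yx∈))

  edge-info : ∀ i x y → e i x y ≡ 1ℤ → T (adj G x y) × col f x y ≡ lookup cs i
  edge-info i x y e≡1 with (x , y) ∈? class i | (y , x) ∈? class i
  ... | yes xy∈ | _ = Equivalence.from T-≡ (proj₁ (proj₂ (class-edge i xy∈))) , proj₂ (proj₂ (class-edge i xy∈))
  ... | no _ | yes yx∈ = subst T (SimpleGraph.sym G y x) adj-yx , trans (sym (colSym f y x adj-yx)) (proj₂ (proj₂ (class-edge i yx∈)))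
    where
    adj-yx : T (adj G y x)
    adj-yx = Equivalence.from T-≡ (proj₁ (proj₂ (class-edge i yx∈)))
  ... | no xy∉ | no yx∉ with () ← trans (sym e≡1) (e-∉ xy∉ yx∉)

  no-rainbow : ∀ x y z i j l → e i x y ≡ 1ℤ → e j x z ≡ 1ℤ → e l y z ≡ 1ℤ → i ≡ j ⊎ i ≡ l ⊎ j ≡ l
  no-rainbow x y z i j l xy xz yz with i Fin.≟ j | i Fin.≟ l | j Fin.≟ l
  ... | yes i≡j | _ | _ = inj₁ i≡j
  ... | no _ | yes i≡l | _ = inj₂ (inj₁ i≡l)
  ... | no _ | no _ | yes j≡l = inj₂ (inj₂ j≡l)
  ... | no i≢j | no i≢l | no j≢l = ⊥-elim (¬rainbow (x , y , z , proj₁ xy′ , proj₁ yz′ , proj₁ xz′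
      , (λ eq → i≢l (lookup-injective cs! i l (trans (sym (proj₂ xy′)) (trans eq (proj₂ yz′)))))
      , (λ eq → j≢l (lookup-injective cs! j l (trans (sym (proj₂ xz′)) (trans (sym eq) (proj₂ yz′)))))
      , (λ eq → i≢j (lookup-injective cs! i j (trans (sym (proj₂ xy′)) (trans eq (proj₂ xz′)))))))
    where
    xy′ = edge-info i x y xy
    xz′ = edge-info j x z xz
    yz′ = edge-info l y z yz

  rainbowFree : RainbowFree N n (+ k)
  rainbowFree = record
    { e = e
    ; e-sym = λ i x y → lem (occurrences (class i) x y) (occurrences (class i) y x)
    ; e-irrefl = λ i x → e-∉ {i} (irrefl′ i x) (irrefl′ i x)
    ; palette = palette
    ; size = λ i → trans (∑₂-+ (occurrences (class i)) (λ x y → occurrences (class i) y x))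
        (trans (cong₂ _+_ (count i) (trans (∑-swap (λ x y → occurrences (class i) y x)) (count i))) (lem₂ (+ k)))
    ; no-rainbow = no-rainbow
    }
    where
    lem : ∀ p q → p + q ≡ q + p
    lem = solve-∀
    lem₂ : ∀ p → p + p ≡ + 2 * p
    lem₂ = solve-∀
    irrefl′ : ∀ i x → (x , x) ∉ class i
    irrefl′ i x ∈i = ℕ.<-irrefl refl (proj₁ (class-edge i ∈i))
    count : ∀ i → ∑₂ (occurrences (class i)) ≡ + k
    count i = trans (∑₂-occurrences (class i)) (cong +_ (class-length i))

-- Sign conditions on constants, decided by evaluation. Since `φ` is `φ₁ k - 3 r` along `n = b k`,
-- `φ-negative` says that it is negative at `k = κ - 1`.
record Admissible (b κ p r : ℤ) : Set where
  open Numeric b κ p r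
  field
    0≤r : 0≤ r
    0≤b-1 : 0≤ b - 1ℤ
    0≤φ₁ : 0≤ φ₁
    φ-negative : 0≤ + 3 * r - φ₁ * (κ - 1ℤ) - 1ℤ
    0≤C₀ : 0≤ C₀
    0≤C₁ : 0≤ C₁
    0≤C₂ : 0≤ C₂
    0≤C₃ : 0≤ C₃
    0≤C₄ : 0≤ C₄
    linear₁ : 0≤ + 43 * b - + 128
    linear₀ : 0≤ + 160 - + 43 * (b - 1ℤ)
    mixed₁ : 0≤ + 58 - + 14 * b
    mixed₀ : 0≤ (+ 58 - + 14 * b) * κ - + 26
    slope₁ : 0≤ s₁
    slope₀ : 0≤ s₁ * κ + + 80 - + 75 * (b - 1ℤ)

0≤-cancel-≥1 : ∀ {m x} → 0≤ m - 1ℤ → 0≤ m * x → 0≤ x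
0≤-cancel-≥1 {m} {x} 1≤m 0≤mx with 0≤-split x
... | inj₁ 0≤x = 0≤x
... | inj₂ x<0 = 0≤-resp (lem m x) (0≤-+ (0≤-+ 0≤mx (0≤-* 1≤m x<0)) 1≤m)
  where
  lem : ∀ m x → x ≡ m * x + (m - 1ℤ) * (-1ℤ - x) + (m - 1ℤ)
  lem = solve-∀

module Contradiction {b κ p r : ℤ} (adm : Admissible b κ p r) {N n k m E : ℤ}
  (m-eq : m ≡ N * k) (E-eq : E ≡ + 3 * (n * (k - 1ℤ)) + + 2 * (n * n) - + 8 * m)
  (1≤N : 0≤ N - 1ℤ) (1≤n : 0≤ n - 1ℤ) (1≤k : 0≤ k - 1ℤ)
  (0≤j : 0≤ b * k - n) (0≤J : 0≤ n - (b * k - (b - 1ℤ))) (colours : 0≤ r * N - p * n) (0≤mE : 0≤ m * E) where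
  open Admissible adm
  open Numeric b κ p r

  0≤-from-1≤ : ∀ {x} → 0≤ x - 1ℤ → 0≤ x
  0≤-from-1≤ {x} 1≤x = 0≤-resp (lem x) (0≤-+ 1≤x (0≤ᵐ 1))
    where
    lem : ∀ x → x ≡ x - 1ℤ + 1ℤ
    lem = solve-∀

  0≤n : 0≤ n
  0≤n = 0≤-from-1≤ 1≤n

  0≤k : 0≤ k
  0≤k = 0≤-from-1≤ 1≤k

  1≤m : 0≤ m - 1ℤ
  1≤m = 0≤-resp (trans (cong (_- 1ℤ) m-eq) (lem N k)) (0≤-+ (0≤-+ (0≤-* 1≤N 1≤k) 1≤N) 1≤k)
    where
    lem : ∀ N k → N * k - 1ℤ ≡ (N - 1ℤ) * (k - 1ℤ) + (N - 1ℤ) + (k - 1ℤ)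
    lem = solve-∀

  0≤E : 0≤ E
  0≤E = 0≤-cancel-≥1 {m} {E} 1≤m 0≤mE

  -- The difference is `8 k (r N - p n)`: a surplus of colours is a surplus of edges, which narrows
  -- Goodman's gap.
  E≤φ : 0≤ n * φ n k - r * E
  E≤φ = 0≤-resp
    (trans (cong (λ s → n * φ n k - r * s) (trans E-eq (cong (λ s → + 3 * (n * (k - 1ℤ)) + + 2 * (n * n) - + 8 * s) m-eq))) (lem n k N p r))
    (0≤-* (0≤-* (0≤ᵐ 8) 0≤k) colours)
    where
    lem : ∀ n k N p r →
      n * (r * (+ 3 * (k - 1ℤ) + + 2 * n) - + 8 * (p * k)) - r * (+ 3 * (n * (k - 1ℤ)) + + 2 * (n * n) - + 8 * (N * k))
      ≡ + 8 * k * (r * N - p * n)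
    lem = solve-∀

  0≤φ : 0≤ φ n k
  0≤φ = 0≤-cancel-≥1 {n} {φ n k} 1≤n (0≤-resp (lem (n * φ n k) (r * E)) (0≤-+ E≤φ (0≤-* 0≤r 0≤E)))
    where
    lem : ∀ x y → x ≡ x - y + y
    lem = solve-∀

  -- For smaller `k`, Goodman's bound alone is violated: `n ≤ b k` gives `φ ≤ φ₁ k - 3 r < 0`.
  0≤K : 0≤ k - κ
  0≤K with 0≤-split (k - κ)
  ... | inj₁ 0≤K = 0≤K
  ... | inj₂ k<κ = ⊥-elim (¬0≤-1 (lem n k b κ p r)
    (0≤-+ (0≤-+ (0≤-+ 0≤φ (0≤-* 0≤φ₁ k<κ)) (0≤-* (0≤-* (0≤ᵐ 2) 0≤r) 0≤j)) φ-negative))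
    where
    lem : ∀ n k b κ p r → r * (+ 3 * (k - 1ℤ) + + 2 * n) - + 8 * (p * k)
      + (+ 3 * r + + 2 * (b * r) - + 8 * p) * (-1ℤ - (k - κ)) + + 2 * r * (b * k - n)
      + (+ 3 * r - (+ 3 * r + + 2 * (b * r) - + 8 * p) * (κ - 1ℤ) - 1ℤ) ≡ -1ℤ
    lem = solve-∀

  k≤n : 0≤ n - k
  k≤n = 0≤-resp (lem n k b) (0≤-+ 0≤J (0≤-* 0≤b-1 1≤k))
    where
    lem : ∀ n k b → n - k ≡ n - (b * k - (b - 1ℤ)) + (b - 1ℤ) * (k - 1ℤ)
    lem = solve-∀

  linear : 0≤ + 80 * E + n * (+ 43 * n - + 128 * k + + 160)
  linear = 0≤-+ (0≤-* (0≤ᵐ 80) 0≤E) (0≤-* 0≤n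
    (0≤-resp (lem n k b) (0≤-+ (0≤-+ (0≤-* (0≤ᵐ 43) 0≤J) (0≤-* linear₁ 0≤k)) linear₀)))
    where
    lem : ∀ n k b → + 43 * n - + 128 * k + + 160
      ≡ + 43 * (n - (b * k - (b - 1ℤ))) + (+ 43 * b - + 128) * k + (+ 160 - + 43 * (b - 1ℤ))
    lem = solve-∀

  mixed : 0≤ + 58 * E + n * (+ 58 * k - + 14 * n - + 26)
  mixed = 0≤-+ (0≤-* (0≤ᵐ 58) 0≤E) (0≤-* 0≤n
    (0≤-resp (lem n k b κ) (0≤-+ (0≤-+ (0≤-* (0≤ᵐ 14) 0≤j) (0≤-* mixed₁ 0≤K)) mixed₀)))
    where
    lem : ∀ n k b κ → + 58 * k - + 14 * n - + 26
      ≡ + 14 * (b * k - n) + (+ 58 - + 14 * b) * (k - κ) + ((+ 58 - + 14 * b) * κ - + 26)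
    lem = solve-∀

  slope : 0≤ + 75 * n - + 64 * k + + 80
  slope = 0≤-resp (lem n k b κ) (0≤-+ (0≤-+ (0≤-* (0≤ᵐ 75) 0≤J) (0≤-* slope₁ 0≤K)) slope₀)
    where
    lem : ∀ n k b κ → + 75 * n - + 64 * k + + 80
      ≡ + 75 * (n - (b * k - (b - 1ℤ))) + (+ 75 * b - + 64) * (k - κ) + ((+ 75 * b - + 64) * κ + + 80 - + 75 * (b - 1ℤ))
    lem = solve-∀

  impossible : ∀ {Φ} →
    Φ ≡ n * n * (+ 72 * n + + 112 * k + + 80 - + 4 * ((k - 1ℤ) * (+ 6 * n - + 11 * k + + 15)))
        + E * (n * (+ 75 * n - + 64 * k + + 80)) + + 20 * (E * E) →
    0≤ m * Φ → ⊥
  impossible {Φ} Φ-eq 0≤mΦ =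
    quadratic-contradiction n r (+ 72 * n + + 112 * k + + 80 - + 4 * ((k - 1ℤ) * (+ 6 * n - + 11 * k + + 15)))
      (+ 75 * n - + 64 * k + + 80) (φ n k) E 1≤n 0≤r 0≤E slope E≤φ
      (gap-positive 0≤C₀ 0≤C₁ 0≤C₂ 0≤C₃ 0≤C₄ n k 0≤K 0≤j 0≤J)
      (0≤-resp (sym Φ-eq) (0≤-cancel-≥1 {m} {Φ} 1≤m 0≤mΦ))

no-RainbowFree : ∀ {b κ p r} → Admissible b κ p r → ∀ {N n k : ℕ} → RainbowFree N n (+ k) →
  0≤ + N - 1ℤ → 0≤ + n - 1ℤ → 0≤ + k - 1ℤ →
  0≤ b * + k - + n → 0≤ + n - (b * + k - (b - 1ℤ)) → 0≤ r * + N - p * + n → ⊥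
no-RainbowFree adm {N} {n} {k} C 1≤N 1≤n 1≤k 0≤j 0≤J colours =
  impossible {Φ} Φ-eq (0≤mΦ (0≤ᵐ k) k≤n linear mixed)
  where
  open Coloured C using (m; E; Φ; E-eq; Φ-eq; 0≤mE; 0≤mΦ)
  open Contradiction adm {+ N} {+ n} {+ k} {m} {E} refl E-eq 1≤N 1≤n 1≤k 0≤j 0≤J colours 0≤mE

-- From the hypotheses on the graph to the numerical conditions

multiply-ratio : ∀ aN aD p r n N .{{_ : ℕ.NonZero aD}} → aD ℕ.* p ℕ.≤ aN ℕ.* r → aN ℕ.* n ℕ.≤ aD ℕ.* N →
  p ℕ.* n ℕ.≤ r ℕ.* N
multiply-ratio aN aD p r n N p/r≤a an≤N = ℕ.*-cancelˡ-≤ aD (begin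
  aD ℕ.* (p ℕ.* n) ≡⟨ ℕ.*-assoc aD p n ⟨
  aD ℕ.* p ℕ.* n   ≤⟨ ℕ.*-monoˡ-≤ n p/r≤a ⟩
  aN ℕ.* r ℕ.* n   ≡⟨ cong (ℕ._* n) (ℕ.*-comm aN r) ⟩
  r ℕ.* aN ℕ.* n   ≡⟨ ℕ.*-assoc r aN n ⟩
  r ℕ.* (aN ℕ.* n) ≤⟨ ℕ.*-monoʳ-≤ r an≤N ⟩
  r ℕ.* (aD ℕ.* N) ≡⟨ ℕ.*-assoc r aD N ⟨
  r ℕ.* aD ℕ.* N   ≡⟨ cong (ℕ._* N) (ℕ.*-comm r aD) ⟩
  aD ℕ.* r ℕ.* N   ≡⟨ ℕ.*-assoc aD r N ⟩
  aD ℕ.* (r ℕ.* N) ∎)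
  where open ℕ.≤-Reasoning

-- Vertices, colours and `k = q + 1` appear as successors. With remainder `s`, the excess of
-- `(b + 1) k` over the number of vertices is `b - s`, which gives both rounding bounds.
few-colours : ∀ {b κ p r} → Admissible (+ suc b) κ (+ p) (+ r) → ∀ N n q s → n ≡ s ℕ.+ q ℕ.* suc b → s ℕ.≤ b →
  p ℕ.* suc n ℕ.≤ r ℕ.* suc N → ¬ RainbowFree (suc N) (suc n) (+ suc q)
few-colours {b} {p = p} {r} adm N n q s n-eq s≤b many C = no-RainbowFree adm C (0≤ᵐ N) (0≤ᵐ n) (0≤ᵐ q)
  (0≤-resp (trans (cong (λ t → + suc b * + suc q - t) n-eq′) (trans (upper (+ suc b) (+ q) (+ s)) (trans (m-n≡m⊖n b s) (⊖-≥ s≤b)))) (0≤ᵐ (b ℕ.∸ s)))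
  (0≤-resp (trans (cong (λ t → t - (+ suc b * + suc q - (+ suc b - 1ℤ))) n-eq′) (lower (+ suc b) (+ q) (+ s))) (0≤ᵐ s))
  (i≤j⇒0≤j-i (subst₂ _≤_ (pos-* p (suc n)) (pos-* r (suc N)) (+≤+ many)))
  where
  n-eq′ : + suc n ≡ 1ℤ + (+ s + + q * + suc b)
  n-eq′ = trans (cong (λ t → + suc t) n-eq) (cong (λ t → 1ℤ + (+ s + t)) (pos-* q (suc b)))
  upper : ∀ B q s → B * (1ℤ + q) - (1ℤ + (s + q * B)) ≡ B - 1ℤ - s
  upper = solve-∀
  lower : ∀ B q s → 1ℤ + (s + q * B) - (B * (1ℤ + q) - (B - 1ℤ)) ≡ s
  lower = solve-∀

-- Dividing the predecessor rounds up: `suc (n / suc b)` is the ceiling of `suc n` over `suc b`.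
quotient< : ∀ n b size → suc n ℕ.≤ suc b ℕ.* size → n ℕ./ suc b ℕ.< size
quotient< n b size n< = ℕ.*-cancelˡ-< (suc b) (n ℕ./ suc b) size
  (ℕ.≤-<-trans (ℕ.≤-trans (ℕ.≤-reflexive (ℕ.*-comm (suc b) (n ℕ./ suc b))) (m/n*n≤m n (suc b))) n<)

large-classes : ∀ {n b} (G : SimpleGraph (suc n)) (f : EdgeColoring G) c cs → Unique (c ∷ cs) →
  All (λ c → suc n ℕ.≤ suc b ℕ.* classSize G f c) (c ∷ cs) → ¬ HasRainbowTriangle G f →
  RainbowFree (suc (length cs)) (suc n) (+ suc (n ℕ./ suc b))
large-classes {n} {b} G f c cs cs! large =
  FromGraph.rainbowFree G f (c ∷ cs) cs! (suc (n ℕ./ suc b)) (All.map (λ {c} → quotient< n b (classSize G f c)) large)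

many-colours : ∀ {b κ p r} → Admissible (+ suc b) κ (+ p) (+ r) → ∀ n (G : SimpleGraph (suc n)) (f : EdgeColoring G) c cs →
  p ℕ.* suc n ℕ.≤ r ℕ.* suc (length cs) → Unique (c ∷ cs) →
  All (λ c → suc n ℕ.≤ suc b ℕ.* classSize G f c) (c ∷ cs) → ¬ ¬ HasRainbowTriangle G f
many-colours {b} adm n G f c cs many cs! large ¬rainbow =
  few-colours adm (length cs) n (n ℕ./ suc b) (n ℕ.% suc b) (m≡m%n+[m/n]*n n (suc b)) (ℕ.s≤s⁻¹ (m%n<n n (suc b)))
    many (large-classes G f c cs cs! large ¬rainbow)

-- In the applications p / r is slightly below aN / aD, with smaller terms.
triangular : ∀ {b κ p r} → Admissible (+ suc b) κ (+ p) (+ r) → ∀ aN aD .{{_ : ℕ.NonZero aN}} .{{_ : ℕ.NonZero aD}} →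
  aD ℕ.* p ℕ.≤ aN ℕ.* r → Triangular aN aD (suc b)
triangular adm aN aD p/r≤a (suc n) _ G f [] cs! many large =
  ⊥-elim (ℕ.<⇒≱ (ℕ.*-mono-≤ (ℕ.>-nonZero⁻¹ aN) (ℕ.s≤s (ℕ.z≤n {n})))
    (subst (aN ℕ.* suc n ℕ.≤_) (ℕ.*-zeroʳ aD) many))
triangular {p = p} {r} adm aN aD p/r≤a (suc n) _ G f (c ∷ cs) cs! many large =
  decidable-stable (hasRainbowTriangle? G f)
    (many-colours adm n G f c cs (multiply-ratio aN aD p r (suc n) (suc (length cs)) p/r≤a many) cs! large)

-- Along `n = 3 k`, `φ` is `4 k - 84`, whence 21.
admissible₃ : Admissible (+ 3) (+ 21) (+ 31) (+ 28)
admissible₃ = record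
  { 0≤r = 0≤ᵐ _
  ; 0≤b-1 = 0≤ᵐ _
  ; 0≤φ₁ = 0≤ᵐ _
  ; φ-negative = 0≤ᵐ _
  ; 0≤C₀ = 0≤ᵐ _
  ; 0≤C₁ = 0≤ᵐ _
  ; 0≤C₂ = 0≤ᵐ _
  ; 0≤C₃ = 0≤ᵐ _
  ; 0≤C₄ = 0≤ᵐ _
  ; linear₁ = 0≤ᵐ _
  ; linear₀ = 0≤ᵐ _
  ; mixed₁ = 0≤ᵐ _
  ; mixed₀ = 0≤ᵐ _
  ; slope₁ = 0≤ᵐ _
  ; slope₀ = 0≤ᵐ _
  }

-- Along `n = 4 k`, `φ` is `39 k - 543`, whence 14. The ratio is nearly the best for these weights:
-- `C₂` is 7228, a difference of terms above 1.6 million.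
admissible₄ : Admissible (+ 4) (+ 14) (+ 244) (+ 181)
admissible₄ = record
  { 0≤r = 0≤ᵐ _
  ; 0≤b-1 = 0≤ᵐ _
  ; 0≤φ₁ = 0≤ᵐ _
  ; φ-negative = 0≤ᵐ _
  ; 0≤C₀ = 0≤ᵐ _
  ; 0≤C₁ = 0≤ᵐ _
  ; 0≤C₂ = 0≤ᵐ _
  ; 0≤C₃ = 0≤ᵐ _
  ; 0≤C₄ = 0≤ᵐ _
  ; linear₁ = 0≤ᵐ _
  ; linear₀ = 0≤ᵐ _
  ; mixed₁ = 0≤ᵐ _
  ; mixed₀ = 0≤ᵐ _
  ; slope₁ = 0≤ᵐ _
  ; slope₀ = 0≤ᵐ _
  }

theorem1p4 : Triangular 11077 10000 3 × Triangular 13481 10000 4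
theorem1p4 = triangular admissible₃ 11077 10000 (ℕ.≤ᵇ⇒≤ (10000 ℕ.* 31) (11077 ℕ.* 28) _)
           , triangular admissible₄ 13481 10000 (ℕ.≤ᵇ⇒≤ (10000 ℕ.* 244) (13481 ℕ.* 181) _)
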